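{- For all positive integers $n,p$, $$\beta(n,p,2)=\beta^*(n,p,2)=\Theta\left(\min\left\{np^{1/2},\,n^{2/3}p\right\}+n+p\right).$$
   Context: A path system is a pair $S=(V,\Pi)$ where $V$ is a finite set of nodes and $\Pi$ is a finite multiset of paths, each path being a finite sequence of pairwise distinct nodes of $V$. For a path $\pi$, $|\pi|$ denotes its number of nodes, and the size of $S$ is $\|S\|=\sum_{\pi\in\Pi}|\pi|$. A $b$-bridge in $S$ consists of $b$ distinct nodes $v_1,\dots,v_b$ and $b$ distinct paths $\pi_1,\dots,\pi_b\in\Pi$ such that for each $1\le i\le b-1$ both $v_i,v_{i+1}$ lie on $\pi_i$ with $v_i$ preceding $v_{i+1}$, and $v_1,v_b$ lie on $\pi_b$ with $v_1$ preceding $v_b$; $\pi_b$ is called the river and $\pi_1,\dots,\pi_{b-1}$ the arcs. The bridge girth of $S$ is the least $b$ for which $S$ contains a $b$-bridge ($\infty$ if none). For positive integers $n,p$ and $k\in\mathbb{Z}_{\ge1}\cup\{\infty\}$, $\beta(n,p,k)$ is the maximum size of a path system with $n$ nodes, $p$ paths and bridge girth $>k$. An ordered path system is a path system together with a total order on its paths; an ordered bridge is a bridge whose river comes after all of its arcs in this order (the arcs may be in any order relative to each other). The ordered bridge girth is the least $b$ for which there is an ordered $b$-bridge, and $\beta^*(n,p,k)$ is the maximum size of an ordered path system with $n$ nodes, $p$ paths and ordered bridge girth $>k$. Asymptotic notation is with respect to $n,p$ with absolute constants. -}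

module Defs where

open import Data.Nat using (ℕ; zero; suc; _+_; _*_; _^_; _≤_; _<_; _≤?_; _⊓_)
open import Data.Fin using (Fin; inject₁; fromℕ) renaming (_<_ to _<ᶠ_)
open import Data.List using (List; length; lookup; map; allFin)
open import Data.Nat.ListAction using (sum)
open import Data.List.Relation.Unary.Unique.Propositional using (Unique)
open import Data.Product using (Σ; ∃; _×_)
open import Function.Definitions using (Injective)
open import Relation.Binary.PropositionalEquality using (_≡_)
open import Relation.Nullary using (¬_; yes; no)

-- A path system with node set Fin n and p paths (a multiset of paths,
-- listed as a family indexed by Fin p; the index order doubles as the
-- total order of an ordered path system).
record PathSystem (n p : ℕ) : Set where
  field
    path   : Fin p → List (Fin n)
    unique : ∀ i → Unique (path i)
open PathSystem public

size : ∀ {n p} → PathSystem n p → ℕ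
size {p = p} S = sum (map (λ i → length (path S i)) (allFin p))

Precedes : ∀ {n} → List (Fin n) → Fin n → Fin n → Set
Precedes l x y =
  Σ (Fin (length l)) λ i → Σ (Fin (length l)) λ j →
    (i <ᶠ j) × (lookup l i ≡ x) × (lookup l j ≡ y)

-- A (suc b)-bridge: distinct nodes v₀..v_b, distinct paths π₀..π_b
-- (π_b is the river).
record Bridge {n p} (S : PathSystem n p) (b : ℕ) : Set where
  field
    v     : Fin (suc b) → Fin n
    π     : Fin (suc b) → Fin p
    v-inj : Injective _≡_ _≡_ v
    π-inj : Injective _≡_ _≡_ π
    arcs  : ∀ (i : Fin b) →
              Precedes (path S (π (inject₁ i))) (v (inject₁ i)) (v (Fin.suc i))
    river : Precedes (path S (π (fromℕ b))) (v Fin.zero) (v (fromℕ b))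

record OrderedBridge {n p} (S : PathSystem n p) (b : ℕ) : Set where
  field
    bridge : Bridge S b
    order  : ∀ (i : Fin b) →
               Bridge.π bridge (inject₁ i) <ᶠ Bridge.π bridge (fromℕ b)

GirthGt : ∀ {n p} → PathSystem n p → ℕ → Set
GirthGt S k = ∀ b → suc b ≤ k → ¬ Bridge S b

OrderedGirthGt : ∀ {n p} → PathSystem n p → ℕ → Set
OrderedGirthGt S k = ∀ b → suc b ≤ k → ¬ OrderedBridge S b

IsBeta : ℕ → ℕ → ℕ → ℕ → Set
IsBeta n p k m =
  (Σ (PathSystem n p) λ S → GirthGt S k × size S ≡ m) ×
  (∀ (S : PathSystem n p) → GirthGt S k → size S ≤ m)

IsBetaStar : ℕ → ℕ → ℕ → ℕ → Set
IsBetaStar n p k m =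
  (Σ (PathSystem n p) λ S → OrderedGirthGt S k × size S ≡ m) ×
  (∀ (S : PathSystem n p) → OrderedGirthGt S k → size S ≤ m)

rootAux : ℕ → ℕ → ℕ → ℕ
rootAux k m zero = zero
rootAux k m (suc r) with suc r ^ k ≤? m
... | yes _ = suc r
... | no  _ = rootAux k m r

root : ℕ → ℕ → ℕ
root k m = rootAux k m m

bound : ℕ → ℕ → ℕ
bound n p = ((n * root 2 p) ⊓ (root 3 (n ^ 2) * p)) + n + p

{-# OPTIONS --safe #-}
module Submission where

-- Bridge girth > 2, ordered or not, means that no two paths visit two common
-- nodes in the same order.  Hence of three paths through the same two nodes two
-- would agree, so the incidence matrix is K₂,₃-free: counting pairs of nodes on
-- a path gives size = O(n√p + p), and counting triples of paths through a node
-- gives size = O(n^(2/3) p + n).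
--
-- For the lower bound take the quadratic polynomials P over a prime field 𝔽_q
-- as nodes and the q² pairs (t , c) as paths, where (t , c) visits the P with
-- P(t) = c in the order of P′(t).  If P and R agree at t ≠ s, then
-- (P − R)′(t) = −(P − R)′(s), so the two paths visit them in opposite orders,
-- provided that derivatives are restricted to half of the residues, where the
-- sign of a difference is well defined.  Taking q ≈ n^(1/3) or q ≈ √p and a
-- part of the paths or of the nodes gives the two regimes.
--
-- A prime of every order of magnitude exists by Chebyshev's argument: every
-- common multiple of 1 , … , 2m is at least C(2m,m) ≥ 2^m, one such multiple is
-- the primorial of 2m times a power of (√2m)!, and the primorial of 2^j is at
-- most 4^(2^j).

open import Defs
open import Data.Nat
open import Data.Nat.Properties
open import Data.Nat.Divisibility
open import Data.Nat.DivMod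
open import Data.Nat.Primality
open import Data.Nat.Combinatorics hiding (_P_) renaming (_C_ to _choose_)
open import Data.Nat.Coprimality as Coprimality using (Coprime)
import Data.Nat.ListAction as ListAction
open import Data.Nat.Tactic.RingSolver using (solve-∀)
open import Data.Integer as ℤ using (ℤ) renaming (+_ to pos)
import Data.Integer.Properties as ℤ
import Data.Integer.Divisibility.Signed as ℤ
import Data.Integer.Tactic.RingSolver as ℤSolver
open import Algebra.Properties.Semiring.Sum +-*-semiring
  using (sum; ∑-comm; ∑-distrib-+; *-distribˡ-sum; *-distribʳ-sum; sum-cong-≗; sum-permute)
open import Data.Bool using (if_then_else_)
open import Data.Fin as Fin using (Fin; zero; suc; toℕ; fromℕ<)
import Data.Fin.Properties as Fin
open import Data.Fin.Permutation using (permutation)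
open import Data.List as List
  using (List; []; _∷_; length; map; allFin; tabulate; filter; cartesianProductWith)
open import Data.List.Properties using (map-tabulate; length-tabulate)
open import Data.List.Extrema.Nat using (argmax; argmax-all; f[xs]≤f[argmax])
open import Data.List.Membership.Propositional using (_∈_)
open import Data.List.Membership.Propositional.Properties
  using (∈-cartesianProductWith⁺; ∈-allFin; ∈-filter⁺; ∈-filter⁻; ∈-lookup)
open import Data.List.Relation.Binary.Permutation.Propositional using (↭-sym; ↭⇒↭ₛ)
open import Data.List.Relation.Binary.Permutation.Propositional.Properties using (∈-resp-↭)
import Data.List.Relation.Binary.Permutation.Setoid.Properties as Permutationₛ
open import Data.List.Relation.Unary.All as All using (All; []; _∷_)
open import Data.List.Relation.Unary.All.Properties using (All¬⇒¬Any; all-filter)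
open import Data.List.Relation.Unary.AllPairs using (AllPairs; []; _∷_)
open import Data.List.Relation.Unary.Any as Any using (here; there)
open import Data.List.Relation.Unary.Any.Properties using (lookup-index)
open import Data.List.Relation.Unary.Sorted.TotalOrder.Properties using (Sorted⇒AllPairs)
open import Data.List.Relation.Unary.Unique.Propositional using (Unique)
import Data.List.Relation.Unary.Unique.Propositional.Properties as Unique
open import Data.List.Relation.Unary.Unique.DecPropositional using (unique?)
import Data.List.Sort as Sort
open import Data.Vec as Vec using (Vec; []; _∷_)
open import Data.Vec.Properties using (lookup-replicate; lookup∘tabulate)
open import Data.Product using (Σ; ∃; _×_; _,_; proj₁; proj₂)
open import Data.Sum using (_⊎_; inj₁; inj₂; [_,_]′)
open import Data.Empty using (⊥)
open import Function using (_∘_; id)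
open import Function.Definitions using (Injective)
open import Relation.Binary.Bundles using (DecTotalOrder)
import Relation.Binary.Construct.On as On
open import Relation.Binary.Definitions using (tri<; tri≈; tri>)
open import Relation.Binary.PropositionalEquality
open import Relation.Nullary using (¬_; Dec; does; yes; no; contradiction; ¬?)
open import Relation.Nullary.Decidable using (from-yes; _×-dec_; _→-dec_)
open import Relation.Unary using (Decidable)

-- Odd primes of every order of magnitude

-- The absorption identity for binomial coefficients, from Pascal's rule and the induction
-- hypothesis at both neighbours.
C-absorb : ∀ n k → suc k * (suc n choose suc k) ≡ suc n * (n choose k)
C-absorb zero zero = refl
C-absorb zero (suc k) = trans (cong (suc (suc k) *_) (k>n⇒nCk≡0 (s≤s (s≤s (z≤n {k}))))) (*-zeroʳ (suc (suc k)))
C-absorb (suc n) zero = trans (*-identityˡ _) (trans (nC1≡n (suc (suc n))) (sym (*-identityʳ _)))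
C-absorb (suc n) (suc k) = begin
  suc (suc k) * (suc (suc n) choose suc (suc k))
    ≡⟨ cong (suc (suc k) *_) (nCk+nC[k+1]≡[n+1]C[k+1] (suc n) (suc k)) ⟨
  suc (suc k) * (A + B)
    ≡⟨ split k A B ⟩
  A + suc k * A + suc (suc k) * B
    ≡⟨ cong₂ (λ u v → A + u + v) (C-absorb n k) (C-absorb n (suc k)) ⟩
  A + suc n * (n choose k) + suc n * (n choose suc k)
    ≡⟨ merge n A (n choose k) (n choose suc k) ⟩
  A + suc n * (n choose k + n choose suc k)
    ≡⟨ cong (λ u → A + suc n * u) (nCk+nC[k+1]≡[n+1]C[k+1] n k) ⟩
  A + suc n * A
    ≡⟨⟩
  suc (suc n) * A ∎
  where
  open ≡-Reasoning
  A = suc n choose suc k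
  B = suc n choose suc (suc k)
  split : ∀ k a b → suc (suc k) * (a + b) ≡ a + suc k * a + suc (suc k) * b
  split = solve-∀
  merge : ∀ n a b c → a + suc n * b + suc n * c ≡ a + suc n * (b + c)
  merge = solve-∀

-- The mirror image of `C-absorb` under the symmetry of a row; writing the row as `c + e` avoids
-- subtraction.
C-absorb′ : ∀ c e → suc e * (suc (c + e) choose c) ≡ suc (c + e) * ((c + e) choose c)
C-absorb′ c e = begin
  suc e * (suc (c + e) choose c)     ≡⟨ cong (suc e *_) (flip (suc (c + e)) c (suc e) (sym (+-suc c e))) ⟩
  suc e * (suc (c + e) choose suc e) ≡⟨ C-absorb (c + e) e ⟩
  suc (c + e) * ((c + e) choose e)   ≡⟨ cong (suc (c + e) *_) (flip (c + e) c e refl) ⟨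
  suc (c + e) * ((c + e) choose c)   ∎
  where
  open ≡-Reasoning
  flip : ∀ n a b → n ≡ a + b → n choose a ≡ n choose b
  flip _ a b refl = trans (nCk≡nC[n∸k] (m≤m+n a b)) (cong ((a + b) choose_) (m+n∸m≡n a b))

-- The Leibniz harmonic triangle 1/z = 1/x − 1/y, for x = c·C(r−1,c),
-- y = c·C(r,c) and z = (c+1)·C(r,c+1), expresses L/z through L/x and L/y.
c*rCc∣commonMultiple : ∀ {n L} → (∀ j → 1 ≤ j → j ≤ n → j ∣ L) →
  ∀ c e → suc c + e ≤ n → suc c * ((suc c + e) choose suc c) ∣ L
c*rCc∣commonMultiple {L = L} common zero e le =
  subst (_∣ L) (sym (trans (*-identityˡ _) (nC1≡n (suc e)))) (common (suc e) (s≤s z≤n) le)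
c*rCc∣commonMultiple {n} {L} common (suc c′) e le
  with c*rCc∣commonMultiple common c′ e (≤-trans (n≤1+n _) le)
     | c*rCc∣commonMultiple common c′ (suc e) (subst (_≤ n) (cong suc (sym (+-suc c′ e))) le)
-- The relation L/z = L/x - L/y makes `k₁ ∸ k₂` the quotient. It is checked after multiplication by
-- `c`, because `c * z`, `r * x` and `suc e * y` coincide.
... | divides k₁ eq₁ | divides k₂ eq₂ = divides (k₁ ∸ k₂) (*-cancelˡ-≡ _ _ c main)
  where
  open ≡-Reasoning
  c = suc c′
  r = suc (c + e)
  x = c * ((c + e) choose c)
  y = c * (r choose c)
  z = suc c * (r choose suc c)
  eq₂′ : L ≡ k₂ * y
  eq₂′ = trans eq₂ (cong (λ u → k₂ * (c * (suc u choose c))) (+-suc c′ e))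
  assoc-comm : ∀ a b d → a * (b * d) ≡ b * (a * d)
  assoc-comm = solve-∀
  cz≡rx : c * z ≡ r * x
  cz≡rx = trans (cong (c *_) (C-absorb (c + e) c)) (assoc-comm c r ((c + e) choose c))
  ey≡rx : suc e * y ≡ r * x
  ey≡rx = begin
    suc e * y               ≡⟨ assoc-comm (suc e) c (r choose c) ⟩
    c * (suc e * (r choose c))   ≡⟨ cong (c *_) (C-absorb′ c e) ⟩
    c * (r * ((c + e) choose c)) ≡⟨ assoc-comm c r ((c + e) choose c) ⟩
    r * x                   ∎
  main : c * L ≡ c * ((k₁ ∸ k₂) * z)
  main = sym (begin
    c * ((k₁ ∸ k₂) * z)             ≡⟨ assoc-comm c (k₁ ∸ k₂) z ⟩
    (k₁ ∸ k₂) * (c * z)             ≡⟨ cong ((k₁ ∸ k₂) *_) cz≡rx ⟩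
    (k₁ ∸ k₂) * (r * x)             ≡⟨ *-distribʳ-∸ (r * x) k₁ k₂ ⟩
    k₁ * (r * x) ∸ k₂ * (r * x)     ≡⟨ cong (λ u → k₁ * (r * x) ∸ k₂ * u) ey≡rx ⟨
    k₁ * (r * x) ∸ k₂ * (suc e * y) ≡⟨ cong₂ _∸_ (assoc-comm k₁ r x) (assoc-comm k₂ (suc e) y) ⟩
    r * (k₁ * x) ∸ suc e * (k₂ * y) ≡⟨ cong₂ (λ u v → r * u ∸ suc e * v) eq₁ eq₂′ ⟨
    r * L ∸ suc e * L               ≡⟨ *-distribʳ-∸ L r (suc e) ⟨
    (r ∸ suc e) * L                 ≡⟨ cong (_* L) (m+n∸n≡m c e) ⟩
    c * L                           ∎)

nC0≡1 : ∀ n → n choose 0 ≡ 1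
nC0≡1 n = trans (nCk≡nC[n∸k] {0} {n} z≤n) (nCn≡1 n)

C≤2^ : ∀ n k → n choose k ≤ 2 ^ n
C≤2^ n zero = ≤-trans (≤-reflexive (nC0≡1 n)) (m^n>0 2 n)
C≤2^ zero (suc k) = ≤-trans (≤-reflexive (k>n⇒nCk≡0 (s≤s (z≤n {k})))) z≤n
C≤2^ (suc n) (suc k) = begin
  suc n choose suc k       ≡⟨ nCk+nC[k+1]≡[n+1]C[k+1] n k ⟨
  n choose k + n choose suc k   ≤⟨ +-mono-≤ (C≤2^ n k) (C≤2^ n (suc k)) ⟩
  2 ^ n + 2 ^ n       ≡⟨ cong (2 ^ n +_) (+-identityʳ (2 ^ n)) ⟨
  2 ^ suc n           ∎
  where open ≤-Reasoning

C-mono : ∀ n k → n choose k ≤ suc n choose k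
C-mono n zero = ≤-reflexive (trans (nC0≡1 n) (sym (nC0≡1 (suc n))))
C-mono n (suc k) = ≤-trans (m≤n+m (n choose suc k) (n choose k)) (≤-reflexive (nCk+nC[k+1]≡[n+1]C[k+1] n k))

-- Pascal's rule splits C(2m+2, m+1) into two entries of row 2m+1, each at least C(2m, m), so the
-- central coefficient at least doubles.
2^≤central : ∀ m → 2 ^ m ≤ (m + m) choose m
2^≤central zero = ≤-refl
2^≤central (suc m) = begin
  2 ^ m + (2 ^ m + 0)
    ≡⟨ cong (2 ^ m +_) (+-identityʳ (2 ^ m)) ⟩
  2 ^ m + 2 ^ m
    ≤⟨ +-mono-≤ (2^≤central m) (2^≤central m) ⟩
  (m + m) choose m + (m + m) choose m
    ≤⟨ +-mono-≤ (C-mono (m + m) m)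
        (≤-trans (m≤m+n _ ((m + m) choose suc m)) (≤-reflexive (nCk+nC[k+1]≡[n+1]C[k+1] (m + m) m))) ⟩
  suc (m + m) choose m + suc (m + m) choose suc m
    ≡⟨ nCk+nC[k+1]≡[n+1]C[k+1] (suc (m + m)) m ⟩
  suc (suc (m + m)) choose suc m
    ≡⟨ cong (λ u → suc u choose suc m) (+-suc m m) ⟨
  (suc m + suc m) choose suc m ∎
  where open ≤-Reasoning

primeOr1 : ℕ → ℕ
primeOr1 n with prime? n
... | yes _ = n
... | no  _ = 1

primorial : ℕ → ℕ
primorial zero    = 1
primorial (suc n) = primeOr1 (suc n) * primorial n

-- The product of the primes in the interval (m, k + m], that is, a quotient of two primorials.
primesAbove : ℕ → ℕ → ℕ
primesAbove m zero    = 1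
primesAbove m (suc k) = primeOr1 (suc (k + m)) * primesAbove m k

primorial-+ : ∀ m k → primorial (k + m) ≡ primesAbove m k * primorial m
primorial-+ m zero    = sym (+-identityʳ _)
primorial-+ m (suc k) = trans (cong (primeOr1 (suc (k + m)) *_) (primorial-+ m k))
                              (sym (*-assoc (primeOr1 (suc (k + m))) _ _))

primeOr1-prime : ∀ {q} → Prime q → primeOr1 q ≡ q
primeOr1-prime {q} pr with prime? q
... | yes _ = refl
... | no ¬pr = contradiction pr ¬pr

prime∣primorial : ∀ {q} n → Prime q → q ≤ n → q ∣ primorial n
prime∣primorial zero    pr z≤n = contradiction pr ¬prime[0]
prime∣primorial {q} (suc n) pr q≤ with q ≟ suc n
... | yes refl = ∣m⇒∣m*n _ (∣-reflexive (sym (primeOr1-prime pr)))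
... | no q≢ = ∣n⇒∣m*n (primeOr1 (suc n)) (prime∣primorial n pr (s≤s⁻¹ (≤∧≢⇒< q≤ q≢)))

prime∤! : ∀ {q} m → Prime q → m < q → q ∤ m !
prime∤! zero pr m<q q∣1 = ¬prime[1] (subst Prime (∣1⇒≡1 q∣1) pr)
prime∤! (suc m) pr m<q q∣ with euclidsLemma (suc m) (m !) pr q∣
... | inj₁ q∣m = >⇒∤ m<q q∣m
... | inj₂ q∣m! = prime∤! m pr (<-trans (n<1+n m) m<q) q∣m!

n∣n! : ∀ n → 1 ≤ n → n ∣ n !
n∣n! (suc n) _ = m∣m*n (n !)

-- The prime divides (2m)! but neither of the two factors m! in the denominator, so by Euclid's
-- lemma it divides the quotient.
prime∣central : ∀ {q} m → Prime q → m < q → q ≤ m + m → q ∣ (m + m) choose m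
prime∣central {q} m pr m<q q≤ with euclidsLemma ((m + m) choose m) (m ! * (m + m ∸ m) !) pr
    (subst (q ∣_) (sym expand) (∣-trans (n∣n! q (≤-trans (s≤s z≤n) m<q)) (m≤n⇒m!∣n! q≤)))
  where
  instance _ = m !* (m + m ∸ m) !≢0
  expand : ((m + m) choose m) * (m ! * (m + m ∸ m) !) ≡ (m + m) !
  expand = trans (cong (_* (m ! * (m + m ∸ m) !)) (nCk≡n!/k![n-k]! (m≤m+n m m)))
                 (m/n*n≡m (k![n∸k]!∣n! (m≤m+n m m)))
... | inj₁ q∣C = q∣C
... | inj₂ q∣!! with euclidsLemma (m !) ((m + m ∸ m) !) pr q∣!!
...   | inj₁ d = contradiction d (prime∤! m pr m<q)
...   | inj₂ d = contradiction (subst (λ u → q ∣ u !) (m+n∸m≡n m m) d) (prime∤! m pr m<q)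

prime∤primesAbove : ∀ {q} m k → Prime q → k + m < q → q ∤ primesAbove m k
prime∤primesAbove m zero pr lt d = ¬prime[1] (subst Prime (∣1⇒≡1 d) pr)
prime∤primesAbove m (suc k) pr lt d with euclidsLemma (primeOr1 (suc (k + m))) (primesAbove m k) pr d
... | inj₂ d′ = prime∤primesAbove m k pr (<-trans (n<1+n _) lt) d′
... | inj₁ d′ with prime? (suc (k + m))
...   | yes _ = >⇒∤ lt d′
...   | no  _ = ¬prime[1] (subst Prime (∣1⇒≡1 d′) pr)

prime∤⇒coprime : ∀ {q n} → Prime q → q ∤ n → Coprime q n
prime∤⇒coprime pr q∤n (d∣q , d∣n) with prime⇒irreducible pr d∣q
... | inj₁ d≡1  = d≡1
... | inj₂ refl = contradiction d∣n q∤n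

coprime-*-∣ : ∀ {a b n} → Coprime a b → a ∣ n → b ∣ n → a * b ∣ n
coprime-*-∣ {a} {b} cop a∣n (divides-refl k) =
  *-monoˡ-∣ b (Coprimality.coprime-divisor cop (subst (a ∣_) (*-comm k b) a∣n))

-- The primes in question divide the coefficient one by one, and each is coprime to the product of
-- the smaller ones.
primesAbove∣central : ∀ m k → k ≤ m → primesAbove m k ∣ (m + m) choose m
primesAbove∣central m zero    k≤m = 1∣ _
primesAbove∣central m (suc k) k<m with prime? (suc (k + m))
... | no  _  = subst (_∣ (m + m) choose m) (sym (*-identityˡ _)) (primesAbove∣central m k (<⇒≤ k<m))
... | yes pr = coprime-*-∣ (prime∤⇒coprime pr (prime∤primesAbove m k pr ≤-refl))
                 (prime∣central m pr (s≤s (m≤n+m m k)) (+-monoˡ-≤ m k<m))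
                 (primesAbove∣central m k (<⇒≤ k<m))

-- Passing from m to 2m multiplies the primorial by a divisor of C(2m, m), hence by at most 4^m.
-- Powers of two make the doubling exact.
primorial-2^ : ∀ j → primorial (2 ^ j) ≤ 4 ^ (2 ^ j)
primorial-2^ zero    = s≤s z≤n
primorial-2^ (suc j) = begin
  primorial (2 ^ suc j)               ≡⟨ cong (λ u → primorial (m + u)) (+-identityʳ m) ⟩
  primorial (m + m)                   ≡⟨ primorial-+ m m ⟩
  primesAbove m m * primorial m       ≤⟨ *-mono-≤ (≤-trans (∣⇒≤ {{C≢0}} (primesAbove∣central m m ≤-refl)) (C≤2^ (m + m) m)) (primorial-2^ j) ⟩
  2 ^ (m + m) * 4 ^ m                 ≡⟨ cong (λ u → 2 ^ (m + u) * 4 ^ m) (+-identityʳ m) ⟨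
  2 ^ (2 * m) * 4 ^ m                 ≡⟨ cong (_* 4 ^ m) (^-*-assoc 2 2 m) ⟨
  4 ^ m * 4 ^ m                       ≡⟨ ^-distribˡ-+-* 4 m m ⟨
  4 ^ (m + m)                         ≡⟨ cong (λ u → 4 ^ (m + u)) (+-identityʳ m) ⟨
  4 ^ (2 ^ suc j)                     ∎
  where
  open ≤-Reasoning
  m = 2 ^ j
  C≢0 : NonZero ((m + m) choose m)
  C≢0 = >-nonZero (≤-trans (m^n>0 2 m) (2^≤central m))

-- Two complementary factors cannot both exceed `s`, since their product is at most `s * s`.
smallFactor : ∀ {j} s → 1 < j → ¬ Prime j → j ≤ s * s →
  ∃ λ u → ∃ λ w → 1 < u × u ≤ s × j ≡ w * u
smallFactor {j} s 1<j ¬pr j≤ss with ¬prime⇒composite {{n>1⇒nonTrivial 1<j}} ¬pr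
... | composite {d} d<j d∣j@(divides a eq) with d ≤? s
...   | yes d≤s = d , a , nonTrivial⇒n>1 d , d≤s , eq
...   | no d≰s with a ≤? s
...     | yes a≤s = a , d , quotient>1 d∣j d<j , a≤s , trans eq (*-comm a d)
...     | no a≰s = contradiction j≤ss
            (<⇒≱ (subst (s * s <_) (sym eq) (*-mono-< (≰⇒> a≰s) (≰⇒> d≰s))))

-- Peeling off factors u ≤ s of a composite j at least halves it, so at most
-- log₂ j of them occur before a prime is left.
commonMultiple : ∀ {n} s → n ≤ s * s → ∀ e j → 1 ≤ j → j ≤ n → j < 2 ^ e → j ∣ primorial n * (s !) ^ e
commonMultiple s n≤ss zero j 1≤j j≤n j<1 = contradiction j<1 (≤⇒≯ 1≤j)
commonMultiple {n} s n≤ss (suc e) j 1≤j j≤n j<2^ with j ≟ 1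
... | yes refl = 1∣ _
... | no j≢1 with prime? j
...   | yes pr = ∣m⇒∣m*n ((s !) ^ suc e) (prime∣primorial n pr j≤n)
...   | no ¬pr with smallFactor s (≤∧≢⇒< 1≤j (≢-sym j≢1)) ¬pr (≤-trans j≤n n≤ss)
...     | u , w , 1<u , u≤s , refl = subst (w * u ∣_) (assoc-comm (primorial n) (s !) ((s !) ^ e))
            (*-pres-∣ (commonMultiple s n≤ss e w 1≤w (≤-trans w≤wu j≤n) w<) (∣-trans (n∣n! u (<⇒≤ 1<u)) (m≤n⇒m!∣n! u≤s)))
  where
  assoc-comm : ∀ a b c → a * c * b ≡ a * (b * c)
  assoc-comm = solve-∀
  1≤w : 1 ≤ w
  1≤w = positive w 1≤j
    where
    positive : ∀ w → 1 ≤ w * u → 1 ≤ w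
    positive (suc _) _ = s≤s z≤n
  w≤wu : w ≤ w * u
  w≤wu = m≤m*n w u {{>-nonZero (<⇒≤ 1<u)}}
  w< : w < 2 ^ e
  w< = *-cancelʳ-< 2 w (2 ^ e) (<-≤-trans (≤-<-trans (*-monoʳ-≤ w 1<u) j<2^) (≤-reflexive (*-comm 2 (2 ^ e))))

!≤^ : ∀ s m → m ≤ s → m ! ≤ s ^ m
!≤^ s zero m≤s = ≤-refl
!≤^ s (suc m) m≤s = *-mono-≤ m≤s (!≤^ s m (<⇒≤ m≤s))

primorial≢0 : ∀ n → NonZero (primorial n)
primorial≢0 zero = _
primorial≢0 (suc n) = m*n≢0 _ _ {{primeOr1≢0}} {{primorial≢0 n}}
  where
  primeOr1≢0 : NonZero (primeOr1 (suc n))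
  primeOr1≢0 with prime? (suc n)
  ... | yes _ = _
  ... | no  _ = _

central∣commonMultiple : ∀ {L} m → 1 ≤ m → (∀ j → 1 ≤ j → j ≤ m + m → j ∣ L) → (m + m) choose m ∣ L
central∣commonMultiple (suc c) _ common = m*n∣⇒n∣ (suc c) _ (c*rCc∣commonMultiple common c (suc c) ≤-refl)

-- Failure of the search is recorded as an empty product, the form in which it enters the bound on
-- the primorial.
findPrime : ∀ m k → (∃ λ q → Prime q × m < q × q ≤ k + m) ⊎ primesAbove m k ≡ 1
findPrime m zero = inj₂ refl
findPrime m (suc k) with prime? (suc (k + m))
... | yes pr = inj₁ (suc (k + m) , pr , s≤s (m≤n+m m k) , ≤-refl)
... | no _ with findPrime m k
...   | inj₁ (q , pr , m<q , q≤) = inj₁ (q , pr , m<q , ≤-trans q≤ (n≤1+n _))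
...   | inj₂ eq = inj₂ (trans (*-identityˡ _) eq)

-- Let N = 2^j and m = 4N, so that 2m = s² with s = 2^i. Without a prime in (N, 8N] the primorial of
-- 2m equals that of N and is at most 4^N. Then 2^(4N) ≤ C(2m, m) ≤ 4^N (s!)^e ≤ 2^(2N + i s e),
-- which contradicts the hypothesis i e s < 2N.
∃prime-in-octave : ∀ i j → 3 + j ≡ i + i → i * suc (i + i) * 2 ^ i < 2 * 2 ^ j →
  ∃ λ q → Prime q × 2 ^ j < q × q ≤ 8 * 2 ^ j
∃prime-in-octave i j 3+j≡2i small with findPrime (2 ^ j) (7 * 2 ^ j)
... | inj₁ (q , pr , lo , hi) = q , pr , lo , ≤-trans hi (≤-reflexive (+-comm (7 * 2 ^ j) (2 ^ j)))
... | inj₂ none = contradiction 2^m≤ (<⇒≱ (^-monoʳ-< 2 (s≤s (s≤s z≤n)) exponents))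
  where
  open ≤-Reasoning
  -- Every j ≤ 2m = 2^(2i) lies below 2^e, as `commonMultiple` requires.
  e = suc (i + i)
  N = 2 ^ j
  m = 4 * N
  s = 2 ^ i
  m+m≡7N+N : m + m ≡ 7 * N + N
  m+m≡7N+N = eight N
    where
    eight : ∀ x → 4 * x + 4 * x ≡ 7 * x + x
    eight = solve-∀
  m+m≡2^2i : m + m ≡ 2 ^ (i + i)
  m+m≡2^2i = trans (eight N) (trans (sym (^-distribˡ-+-* 2 3 j)) (cong (2 ^_) 3+j≡2i))
    where
    eight : ∀ x → 4 * x + 4 * x ≡ 8 * x
    eight = solve-∀
  m+m≡ss : m + m ≡ s * s
  m+m≡ss = trans m+m≡2^2i (^-distribˡ-+-* 2 i i)
  L = primorial (m + m) * (s !) ^ e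
  multiples : ∀ j → 1 ≤ j → j ≤ m + m → j ∣ L
  multiples j 1≤j j≤ = commonMultiple s (≤-reflexive m+m≡ss) e j 1≤j j≤
    (≤-<-trans j≤ (≤-<-trans (≤-reflexive m+m≡2^2i) (^-monoʳ-< 2 (s≤s (s≤s z≤n)) (n<1+n (i + i)))))
  primorial≤ : primorial (m + m) ≤ 2 ^ (2 * N)
  primorial≤ = begin
    primorial (m + m)                   ≡⟨ cong primorial m+m≡7N+N ⟩
    primorial (7 * N + N)               ≡⟨ primorial-+ N (7 * N) ⟩
    primesAbove N (7 * N) * primorial N ≡⟨ cong (_* primorial N) none ⟩
    1 * primorial N                     ≡⟨ *-identityˡ _ ⟩
    primorial N                         ≤⟨ primorial-2^ j ⟩
    4 ^ N                               ≡⟨ ^-*-assoc 2 2 N ⟩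
    2 ^ (2 * N)                         ∎
  s!^e≤ : (s !) ^ e ≤ 2 ^ (i * s * e)
  s!^e≤ = begin
    (s !) ^ e          ≤⟨ ^-monoˡ-≤ e (!≤^ s s ≤-refl) ⟩
    (s ^ s) ^ e        ≡⟨ cong (_^ e) (^-*-assoc 2 i s) ⟩
    (2 ^ (i * s)) ^ e  ≡⟨ ^-*-assoc 2 (i * s) e ⟩
    2 ^ (i * s * e)    ∎
  L≢0 : NonZero L
  L≢0 = m*n≢0 _ _ {{primorial≢0 (m + m)}} {{m^n≢0 (s !) e {{s !≢0}}}}
  2^m≤ : 2 ^ m ≤ 2 ^ (2 * N + i * s * e)
  2^m≤ = begin
    2 ^ m                          ≤⟨ 2^≤central m ⟩
    (m + m) choose m                    ≤⟨ ∣⇒≤ {{L≢0}} (central∣commonMultiple m (≤-trans (m^n>0 2 j) (m≤m+n N _)) multiples) ⟩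
    L                              ≤⟨ *-mono-≤ primorial≤ s!^e≤ ⟩
    2 ^ (2 * N) * 2 ^ (i * s * e)  ≡⟨ ^-distribˡ-+-* 2 (2 * N) (i * s * e) ⟨
    2 ^ (2 * N + i * s * e)        ∎
  exponents : 2 * N + i * s * e < m
  exponents = begin-strict
    2 * N + i * s * e            ≡⟨ cong (2 * N +_) (swap i s e) ⟩
    2 * N + i * e * s            <⟨ +-monoʳ-< (2 * N) small ⟩
    2 * N + 2 * N                ≡⟨ twice N ⟩
    4 * N                        ∎
    where
    swap : ∀ x y z → x * y * z ≡ x * z * y
    swap = solve-∀
    twice : ∀ x → 2 * x + 2 * x ≡ 4 * x
    twice = solve-∀

-- With i = 10 + a this says 4 i (2i + 1) < 2^i. It starts from 210 < 256; in the induction step the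
-- doubled left side exceeds the next one by `2 * a * a + 37 * a + 167`.
exponentBound : ∀ a → (10 + a) * suc ((10 + a) + (10 + a)) < 256 * 2 ^ a
exponentBound zero = ≤ᵇ⇒≤ _ _ _
exponentBound (suc a) = begin-strict
  (11 + a) * suc ((11 + a) + (11 + a))           ≤⟨ m≤m+n _ (2 * a * a + 37 * a + 167) ⟩
  (11 + a) * suc ((11 + a) + (11 + a)) + (2 * a * a + 37 * a + 167) ≡⟨ double a ⟩
  2 * ((10 + a) * suc ((10 + a) + (10 + a)))     <⟨ *-monoʳ-< 2 (exponentBound a) ⟩
  2 * (256 * 2 ^ a)                              ≡⟨ swap (2 ^ a) ⟩
  256 * 2 ^ suc a                                ∎
  where
  open ≤-Reasoning
  double : ∀ a → (11 + a) * suc ((11 + a) + (11 + a)) + (2 * a * a + 37 * a + 167) ≡ 2 * ((10 + a) * suc ((10 + a) + (10 + a)))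
  double = solve-∀
  swap : ∀ x → 2 * (256 * x) ≡ 256 * (2 * x)
  swap = solve-∀

abstract
  -- Here 4^i = 8 · 2^j for j = 2i - 3, so the prime between 2^j and 8 · 2^j loses at most a factor
  -- 8 against 4^i.
  ∃prime-near-4^ : ∀ i → 10 ≤ i → ∃ λ q → Prime q × q ≤ 4 ^ i × 4 ^ suc i ≤ 32 * q
  ∃prime-near-4^ i 10≤i = weaken (∃prime-in-octave i j 3+j≡2i (*-cancelˡ-< 4 _ _ small))
    where
    open ≤-Reasoning
    j : ℕ
    j = i + i ∸ 3
    3+j≡2i : 3 + j ≡ i + i
    3+j≡2i = m+[n∸m]≡n (≤-trans (≤-trans (m≤m+n 3 7) 10≤i) (m≤m+n i i))
    2^2i≡8N : 2 ^ (i + i) ≡ 8 * 2 ^ j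
    2^2i≡8N = trans (cong (2 ^_) (sym 3+j≡2i)) (^-distribˡ-+-* 2 3 j)
    4^i≡8N : 4 ^ i ≡ 8 * 2 ^ j
    4^i≡8N = trans (^-*-assoc 2 2 i) (trans (cong (λ u → 2 ^ (i + u)) (+-identityʳ i)) 2^2i≡8N)
    small : 4 * (i * suc (i + i) * 2 ^ i) < 4 * (2 * 2 ^ j)
    small = begin-strict
      4 * (i * suc (i + i) * 2 ^ i)    ≡⟨ *-assoc 4 (i * suc (i + i)) (2 ^ i) ⟨
      4 * (i * suc (i + i)) * 2 ^ i    <⟨ *-monoˡ-< (2 ^ i) {{m^n≢0 2 i}} four ⟩
      2 ^ i * 2 ^ i                    ≡⟨ ^-distribˡ-+-* 2 i i ⟨
      2 ^ (i + i)                      ≡⟨ 2^2i≡8N ⟩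
      8 * 2 ^ j                        ≡⟨ *-assoc 4 2 (2 ^ j) ⟩
      4 * (2 * 2 ^ j)                  ∎
      where
      four : 4 * (i * suc (i + i)) < 2 ^ i
      four = begin-strict
        4 * (i * suc (i + i))      <⟨ *-monoʳ-< 4 (subst (λ u → u * suc (u + u) < 256 * 2 ^ (i ∸ 10)) (m+[n∸m]≡n 10≤i) (exponentBound (i ∸ 10))) ⟩
        4 * (256 * 2 ^ (i ∸ 10))   ≡⟨ *-assoc 4 256 (2 ^ (i ∸ 10)) ⟨
        1024 * 2 ^ (i ∸ 10)        ≡⟨ ^-distribˡ-+-* 2 10 (i ∸ 10) ⟨
        2 ^ (10 + (i ∸ 10))        ≡⟨ cong (2 ^_) (m+[n∸m]≡n 10≤i) ⟩
        2 ^ i                      ∎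
    weaken : (∃ λ q → Prime q × 2 ^ j < q × q ≤ 8 * 2 ^ j) → ∃ λ q → Prime q × q ≤ 4 ^ i × 4 ^ suc i ≤ 32 * q
    weaken (q , pr , lo , hi) = q , pr , ≤-trans hi (≤-reflexive (sym 4^i≡8N)) , (begin
      4 * 4 ^ i          ≡⟨ cong (4 *_) 4^i≡8N ⟩
      4 * (8 * 2 ^ j)    ≡⟨ *-assoc 4 8 (2 ^ j) ⟨
      32 * 2 ^ j         ≤⟨ *-monoʳ-≤ 32 (<⇒≤ lo) ⟩
      32 * q             ∎)

-- The exponent `k` is lowered until its power no longer exceeds `x`, or until the threshold `i₀` is
-- passed.
log₄ : ∀ i₀ x k → x < 4 ^ k → x < 4 ^ i₀ ⊎ ∃ λ i → i₀ ≤ i × 4 ^ i ≤ x × x < 4 ^ suc i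
log₄ i₀ x zero x< = inj₁ (<-≤-trans x< (m^n>0 4 i₀))
log₄ i₀ x (suc k) x< with x <? 4 ^ k
... | yes x<4^k = log₄ i₀ x k x<4^k
... | no x≮ with i₀ ≤? k
...   | yes i₀≤k = inj₂ (k , i₀≤k , ≮⇒≥ x≮ , x<)
...   | no i₀≰k = inj₁ (<-≤-trans x< (^-monoʳ-≤ 4 (≰⇒> i₀≰k)))

n<4^n : ∀ n → n < 4 ^ n
n<4^n zero = s≤s z≤n
n<4^n (suc n) = begin-strict
  suc n          ≤⟨ n<4^n n ⟩
  4 ^ n          <⟨ m<m+n (4 ^ n) (≤-trans (m^n>0 4 n) (m≤m+n (4 ^ n) _)) ⟩
  4 ^ suc n      ∎
  where open ≤-Reasoning

oddPrime : ∀ {q} → Prime q → 2 < q → ∃ λ h → q ≡ suc (h + h)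
oddPrime {q} pr 2<q with q % 2 | m≡m%n+[m/n]*n q 2 | m%n<n q 2
... | 0 | eq | _ with prime⇒irreducible pr (divides (q / 2) eq)
...   | inj₁ ()
...   | inj₂ refl = contradiction 2<q (<-irrefl refl)
oddPrime {q} pr 2<q | 1 | eq | _ = q / 2 , trans eq (cong suc (double (q / 2)))
  where
  double : ∀ x → x * 2 ≡ x + x
  double = solve-∀
oddPrime {q} pr 2<q | suc (suc _) | _ | s≤s (s≤s ())

4^≤32*⇒2< : ∀ i q → 10 ≤ i → 4 ^ suc i ≤ 32 * q → 2 < q
4^≤32*⇒2< i q 10≤i ≤q = ≰⇒> λ q≤2 → <⇒≱ {64} {4 ^ suc i}
  (^-monoʳ-< 4 (s≤s (s≤s z≤n)) {3} {suc i} (s≤s (≤-trans (m≤m+n 3 7) 10≤i)))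
  (≤-trans ≤q (*-monoʳ-≤ 32 q≤2))

prime[3] : Prime 3
prime[3] = from-yes (prime? 3)

oddPrimeBelow : ∀ i₀ → 10 ≤ i₀ → ∀ x → 3 ≤ x →
  ∃ λ h → Prime (suc (h + h)) × suc (h + h) ≤ x × x ≤ 4 ^ i₀ * suc (h + h)
oddPrimeBelow i₀ 10≤i₀ x 3≤x with log₄ i₀ x x (n<4^n x)
-- Below `4 ^ i₀` the prime 3 will do, since the constant factor absorbs the whole range.
... | inj₁ x< = 1 , prime[3] , 3≤x , ≤-trans (<⇒≤ x<) (m≤m*n (4 ^ i₀) 3)
... | inj₂ (i , i₀≤i , lo , hi) with ∃prime-near-4^ i (≤-trans 10≤i₀ i₀≤i)
...   | q , pr , q≤ , ≤q with oddPrime pr (4^≤32*⇒2< i q (≤-trans 10≤i₀ i₀≤i) ≤q)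
...     | h , q≡ = h , subst Prime q≡ pr , subst (_≤ x) q≡ (≤-trans q≤ lo) , subst (λ u → x ≤ 4 ^ i₀ * u) q≡ (≤-trans (<⇒≤ hi) (≤-trans ≤q (*-monoˡ-≤ q 32≤4^i₀)))
  where
  32≤4^i₀ : 32 ≤ 4 ^ i₀
  32≤4^i₀ = ≤-trans (m≤m+n 32 32) (^-monoʳ-≤ 4 (≤-trans (m≤m+n 3 7) 10≤i₀))

abstract
  -- Being abstract, the constant `4 ^ 10` cannot unfold in later goals.
  oddPrimesDense : ∃ λ K → ∀ x → 3 ≤ x → ∃ λ h → Prime (suc (h + h)) × suc (h + h) ≤ x × x ≤ K * suc (h + h)
  oddPrimesDense = 4 ^ 10 , oddPrimeBelow 10 ≤-refl

-- Double counting

sum-mono : ∀ {n} {f g : Fin n → ℕ} → (∀ i → f i ≤ g i) → sum f ≤ sum g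
sum-mono {zero}  f≤g = z≤n
sum-mono {suc n} f≤g = +-mono-≤ (f≤g zero) (sum-mono (f≤g ∘ suc))

sum-const : ∀ n c → sum {n} (λ _ → c) ≡ n * c
sum-const zero    c = refl
sum-const (suc n) c = cong (c +_) (sum-const n c)

sum≥1⇒∃ : ∀ {n} (f : Fin n → ℕ) → 1 ≤ sum f → ∃ λ i → 1 ≤ f i
sum≥1⇒∃ {suc n} f 1≤ with f zero in eq
... | suc _ = zero , subst (1 ≤_) (sym eq) (s≤s z≤n)
... | zero with sum≥1⇒∃ (f ∘ suc) 1≤
...   | i , 1≤fi = suc i , 1≤fi

infixl 8 _∖_
-- For the indicator function of a set this removes the element `i`; iterating it encodes choices of
-- distinct elements.
_∖_ : ∀ {n} → (Fin n → ℕ) → Fin n → Fin n → ℕ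
(f ∖ i) j = if does (i Fin.≟ j) then 0 else f j

sum-∖ : ∀ {n} (f : Fin n → ℕ) i → sum (f ∖ i) + f i ≡ sum f
sum-∖ f zero    = +-comm (sum (f ∘ suc)) (f zero)
sum-∖ f (suc i) = trans (+-assoc (f zero) _ _) (cong (f zero +_) (sum-∖ (f ∘ suc) i))

∖-≤ : ∀ {n} (f : Fin n → ℕ) i j → (f ∖ i) j ≤ f j
∖-≤ f i j with i Fin.≟ j
... | yes _ = z≤n
... | no  _ = ≤-refl

∖-support : ∀ {n} (f : Fin n → ℕ) i j → 1 ≤ (f ∖ i) j → i ≢ j × 1 ≤ f j
∖-support f i j 1≤ with i Fin.≟ j
... | yes _  = contradiction 1≤ λ ()
... | no i≢j = i≢j , 1≤

sum-∖-≥ : ∀ {n} (f : Fin n → ℕ) → (∀ i → f i ≤ 1) → ∀ i → sum f ∸ 1 ≤ sum (f ∖ i)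
sum-∖-≥ f f≤1 i = m≤n+o⇒m∸n≤o (sum f) 1 (begin
  sum f             ≡⟨ sum-∖ f i ⟨
  sum (f ∖ i) + f i ≤⟨ +-monoʳ-≤ (sum (f ∖ i)) (f≤1 i) ⟩
  sum (f ∖ i) + 1   ≡⟨ +-comm (sum (f ∖ i)) 1 ⟩
  1 + sum (f ∖ i)   ∎)
  where open ≤-Reasoning

sum≤1 : ∀ {n} (f : Fin n → ℕ) → (∀ i → f i ≤ 1) →
  (∀ i j → i ≢ j → 1 ≤ f i → 1 ≤ f j → ⊥) → sum f ≤ 1
sum≤1 f f≤1 no₂ = ≮⇒≥ λ 1<s →
  let i , fi = sum≥1⇒∃ f (<⇒≤ 1<s)
      j , fj = sum≥1⇒∃ (f ∖ i) (≤-trans (∸-monoˡ-≤ 1 1<s) (sum-∖-≥ f f≤1 i))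
      i≢j , fj′ = ∖-support f i j fj
  in no₂ i j i≢j fi fj′

-- Otherwise deleting one element of the support leaves a sum of at least 2, and `sum≤1` applies to
-- what remains.
sum≤2 : ∀ {n} (f : Fin n → ℕ) → (∀ i → f i ≤ 1) →
  (∀ i j k → i ≢ j → i ≢ k → j ≢ k → 1 ≤ f i → 1 ≤ f j → 1 ≤ f k → ⊥) → sum f ≤ 2
sum≤2 f f≤1 no₃ = ≮⇒≥ λ 2<s →
  let i , fi = sum≥1⇒∃ f (≤-trans (s≤s z≤n) 2<s)
      s≤ = ≤-trans (∸-monoˡ-≤ 1 2<s) (sum-∖-≥ f f≤1 i)
  in <⇒≱ s≤ (sum≤1 (f ∖ i) (λ j → ≤-trans (∖-≤ f i j) (f≤1 j)) λ j k j≢k fj fk →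
       let i≢j , fj′ = ∖-support f i j fj
           i≢k , fk′ = ∖-support f i k fk
       in no₃ i j k i≢j i≢k j≢k fi fj′ fk′)

*-support : ∀ {m n} → 1 ≤ m * n → 1 ≤ m × 1 ≤ n
*-support {suc m} {suc n} _ = s≤s z≤n , s≤s z≤n
*-support {suc m} {zero} 1≤ = contradiction (subst (1 ≤_) (*-zeroʳ m) 1≤) λ ()

sum-*-≥ : ∀ {n} (f : Fin n → ℕ) (g : Fin n → ℕ) e → (∀ i → e ≤ g i) → sum f * e ≤ sum (λ i → f i * g i)
sum-*-≥ f g e e≤ = ≤-trans (≤-reflexive (*-distribʳ-sum e f)) (sum-mono λ i → *-monoʳ-≤ (f i) (e≤ i))

-- For a 0/1 function `f`, `pairs` and `triples` are the indicators of the ordered pairs and triples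
-- of distinct elements of its support.
pairs : ∀ {n} → (Fin n → ℕ) → Fin n → Fin n → ℕ
pairs f i j = f i * (f ∖ i) j

triples : ∀ {n} → (Fin n → ℕ) → Fin n → Fin n → Fin n → ℕ
triples f i j k = f i * ((f ∖ i) j * (f ∖ i ∖ j) k)

module _ {n} (f : Fin n → ℕ) (f≤1 : ∀ i → f i ≤ 1) where

  private
    f∖≤1 : ∀ i j → (f ∖ i) j ≤ 1
    f∖≤1 i j = ≤-trans (∖-≤ f i j) (f≤1 j)

  pairs≤1 : ∀ i j → pairs f i j ≤ 1
  pairs≤1 i j = *-mono-≤ (f≤1 i) (f∖≤1 i j)

  triples≤1 : ∀ i j k → triples f i j k ≤ 1
  triples≤1 i j k = *-mono-≤ (f≤1 i) (*-mono-≤ (f∖≤1 i j) (≤-trans (∖-≤ (f ∖ i) j k) (f∖≤1 i k)))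

  -- A support of d elements has d(d-1) ordered pairs. Weakening this to (d-1)² leaves a pure power
  -- for the mean inequality to come.
  sum-pairs : (sum f ∸ 1) * (sum f ∸ 1) ≤ sum λ i → sum λ j → pairs f i j
  sum-pairs = begin
    (sum f ∸ 1) * (sum f ∸ 1)           ≤⟨ *-monoˡ-≤ (sum f ∸ 1) (m∸n≤m (sum f) 1) ⟩
    sum f * (sum f ∸ 1)                 ≤⟨ sum-*-≥ f _ _ (sum-∖-≥ f f≤1) ⟩
    sum (λ i → f i * sum (f ∖ i))       ≡⟨ sum-cong-≗ (λ i → *-distribˡ-sum (f i) (f ∖ i)) ⟩
    sum (λ i → sum λ j → pairs f i j)   ∎
    where open ≤-Reasoning

  -- Likewise d(d-1)(d-2) is weakened to the cube of d-2.
  sum-triples : (sum f ∸ 2) * ((sum f ∸ 2) * (sum f ∸ 2)) ≤ sum λ i → sum λ j → sum λ k → triples f i j k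
  sum-triples = begin
    (sum f ∸ 2) * ((sum f ∸ 2) * (sum f ∸ 2))
      ≤⟨ *-mono-≤ (m∸n≤m (sum f) 2) (*-monoˡ-≤ (sum f ∸ 2) (∸-monoʳ-≤ (sum f) (s≤s (z≤n {1})))) ⟩
    sum f * ((sum f ∸ 1) * (sum f ∸ 2))
      ≤⟨ sum-*-≥ f _ _ inner ⟩
    sum (λ i → f i * sum λ j → sum λ k → (f ∖ i) j * (f ∖ i ∖ j) k)
      ≡⟨ sum-cong-≗ (λ i → trans (*-distribˡ-sum (f i) (λ j → sum λ k → (f ∖ i) j * (f ∖ i ∖ j) k))
           (sum-cong-≗ λ j → *-distribˡ-sum (f i) (λ k → (f ∖ i) j * (f ∖ i ∖ j) k))) ⟩
    sum (λ i → sum λ j → sum λ k → triples f i j k) ∎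
    where
    open ≤-Reasoning
    inner : ∀ i → (sum f ∸ 1) * (sum f ∸ 2) ≤ sum λ j → sum λ k → (f ∖ i) j * (f ∖ i ∖ j) k
    inner i = begin
      (sum f ∸ 1) * (sum f ∸ 2)                         ≤⟨ *-monoˡ-≤ (sum f ∸ 2) (sum-∖-≥ f f≤1 i) ⟩
      sum (f ∖ i) * (sum f ∸ 2)                         ≤⟨ sum-*-≥ (f ∖ i) _ _ (λ j → begin
        sum f ∸ 2           ≡⟨ ∸-+-assoc (sum f) 1 1 ⟨
        sum f ∸ 1 ∸ 1       ≤⟨ ∸-monoˡ-≤ 1 (sum-∖-≥ f f≤1 i) ⟩
        sum (f ∖ i) ∸ 1     ≤⟨ sum-∖-≥ (f ∖ i) (f∖≤1 i) j ⟩
        sum (f ∖ i ∖ j)     ∎) ⟩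
      sum (λ j → (f ∖ i) j * sum (f ∖ i ∖ j))           ≡⟨ sum-cong-≗ (λ j → *-distribˡ-sum ((f ∖ i) j) (f ∖ i ∖ j)) ⟩
      sum (λ j → sum λ k → (f ∖ i) j * (f ∖ i ∖ j) k)   ∎

2ab≤a²+b² : ∀ a b → 2 * (a * b) ≤ a * a + b * b
2ab≤a²+b² a b with ≤-total a b
... | inj₁ a≤b with b ∸ a | m+[n∸m]≡n a≤b
...   | d | refl = ≤-trans (m≤m+n _ (d * d)) (≤-reflexive (expand a d))
  where
  expand : ∀ a d → 2 * (a * (a + d)) + d * d ≡ a * a + (a + d) * (a + d)
  expand = solve-∀
2ab≤a²+b² a b | inj₂ b≤a with a ∸ b | m+[n∸m]≡n b≤a
...   | d | refl = ≤-trans (m≤m+n _ (d * d)) (≤-reflexive (expand b d))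
  where
  expand : ∀ b d → 2 * ((b + d) * b) + d * d ≡ (b + d) * (b + d) + b * b
  expand = solve-∀

-- A crude substitute for the inequality of means: the product is at most the cube of the larger
-- number.
ab²≤a³+b³ : ∀ a b → a * (b * b) ≤ a * (a * a) + b * (b * b)
ab²≤a³+b³ a b with ≤-total a b
... | inj₁ a≤b = ≤-trans (*-monoˡ-≤ (b * b) a≤b) (m≤n+m _ (a * (a * a)))
... | inj₂ b≤a = ≤-trans (*-monoʳ-≤ a (*-mono-≤ b≤a b≤a)) (m≤m+n _ (b * (b * b)))

-- This allows the shifted degrees d-1 and d-2 to replace the degrees; its cost is the linear term
-- of each upper bound.
sum≤const+sum-∸ : ∀ {n} (f : Fin n → ℕ) c → sum f ≤ n * c + sum (λ i → f i ∸ c)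
sum≤const+sum-∸ {n} f c = begin
  sum f                                   ≤⟨ sum-mono (λ i → m≤n+m∸n (f i) c) ⟩
  sum (λ i → c + (f i ∸ c))               ≡⟨ ∑-distrib-+ {n} (λ _ → c) (λ i → f i ∸ c) ⟩
  sum {n} (λ _ → c) + sum (λ i → f i ∸ c) ≡⟨ cong (_+ sum (λ i → f i ∸ c)) (sum-const n c) ⟩
  n * c + sum (λ i → f i ∸ c)             ∎
  where open ≤-Reasoning

-- `M` is an incidence matrix with paths as rows and nodes as columns. The three vertices of the
-- forbidden K₂,₃ are rows, so rows are counted by pairs of columns and columns by triples of rows.
module K₂₃-free {p n} (M : Fin p → Fin n → ℕ) (M≤1 : ∀ i x → M i x ≤ 1)
  (free : ∀ i j k x y → i ≢ j → i ≢ k → j ≢ k → x ≢ y →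
     1 ≤ M i x → 1 ≤ M j x → 1 ≤ M k x → 1 ≤ M i y → 1 ≤ M j y → 1 ≤ M k y → ⊥) where

  total : ℕ
  total = sum λ i → sum λ x → M i x

  degree : Fin n → ℕ
  degree x = sum λ i → M i x

  total≡∑degree : total ≡ sum degree
  total≡∑degree = ∑-comm M

  -- Each ordered pair of distinct nodes lies on at most two paths; summing over the pairs first
  -- gives the bound.
  squares : sum (λ i → (sum (M i) ∸ 1) * (sum (M i) ∸ 1)) ≤ n * (n * 2)
  squares = begin
    sum (λ i → (sum (M i) ∸ 1) * (sum (M i) ∸ 1))
      ≤⟨ sum-mono (λ i → sum-pairs (M i) (M≤1 i)) ⟩
    sum (λ i → sum λ x → sum λ y → pairs (M i) x y)
      ≡⟨ ∑-comm (λ i x → sum λ y → pairs (M i) x y) ⟩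
    sum (λ x → sum λ i → sum λ y → pairs (M i) x y)
      ≡⟨ sum-cong-≗ (λ x → ∑-comm (λ i y → pairs (M i) x y)) ⟩
    sum (λ x → sum λ y → sum λ i → pairs (M i) x y)
      ≤⟨ sum-mono (λ x → sum-mono λ y → sum≤2 (λ i → pairs (M i) x y) (λ i → pairs≤1 (M i) (M≤1 i) x y) (common x y)) ⟩
    sum {n} (λ x → sum {n} λ y → 2)
      ≡⟨ sum-cong-≗ {n} (λ _ → sum-const n 2) ⟩
    sum {n} (λ _ → n * 2)
      ≡⟨ sum-const n (n * 2) ⟩
    n * (n * 2) ∎
    where
    open ≤-Reasoning
    common : ∀ x y i j k → i ≢ j → i ≢ k → j ≢ k →
      1 ≤ pairs (M i) x y → 1 ≤ pairs (M j) x y → 1 ≤ pairs (M k) x y → ⊥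
    common x y i j k i≢j i≢k j≢k Pi Pj Pk =
      let ix , iy = *-support {M i x} Pi
          jx , jy = *-support {M j x} Pj
          kx , ky = *-support {M k x} Pk
          x≢y , iy′ = ∖-support (M i) x y iy
          _ , jy′ = ∖-support (M j) x y jy
          _ , ky′ = ∖-support (M k) x y ky
      in free i j k x y i≢j i≢k j≢k x≢y ix jx kx iy′ jy′ ky′

  -- Each ordered triple of distinct paths has at most one common node.
  cubes : sum (λ x → (degree x ∸ 2) * ((degree x ∸ 2) * (degree x ∸ 2))) ≤ p * (p * (p * 1))
  cubes = begin
    sum (λ x → (degree x ∸ 2) * ((degree x ∸ 2) * (degree x ∸ 2)))
      ≤⟨ sum-mono (λ x → sum-triples (column x) (λ i → M≤1 i x)) ⟩
    sum (λ x → sum λ i → sum λ j → sum λ k → triples (column x) i j k)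
      ≡⟨ ∑-comm (λ x i → sum λ j → sum λ k → triples (column x) i j k) ⟩
    sum (λ i → sum λ x → sum λ j → sum λ k → triples (column x) i j k)
      ≡⟨ sum-cong-≗ (λ i → ∑-comm (λ x j → sum λ k → triples (column x) i j k)) ⟩
    sum (λ i → sum λ j → sum λ x → sum λ k → triples (column x) i j k)
      ≡⟨ sum-cong-≗ (λ i → sum-cong-≗ λ j → ∑-comm (λ x k → triples (column x) i j k)) ⟩
    sum (λ i → sum λ j → sum λ k → sum λ x → triples (column x) i j k)
      ≤⟨ sum-mono (λ i → sum-mono λ j → sum-mono λ k →
           sum≤1 (λ x → triples (column x) i j k) (λ x → triples≤1 (column x) (λ i → M≤1 i x) i j k) (common i j k)) ⟩
    sum {p} (λ _ → sum {p} λ _ → sum {p} λ _ → 1)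
      ≡⟨ sum-cong-≗ {p} (λ _ → trans (sum-cong-≗ {p} λ _ → sum-const p 1) (sum-const p (p * 1))) ⟩
    sum {p} (λ _ → p * (p * 1))
      ≡⟨ sum-const p (p * (p * 1)) ⟩
    p * (p * (p * 1)) ∎
    where
    open ≤-Reasoning
    column : Fin n → Fin p → ℕ
    column x i = M i x
    distinct : ∀ x i j k → 1 ≤ triples (column x) i j k →
      i ≢ j × i ≢ k × j ≢ k × 1 ≤ M i x × 1 ≤ M j x × 1 ≤ M k x
    distinct x i j k T =
      let Mi , T′ = *-support {M i x} T
          Tj , Tk = *-support {(column x ∖ i) j} T′
          i≢j , Mj = ∖-support (column x) i j Tj
          j≢k , Tk′ = ∖-support (column x ∖ i) j k Tk
          i≢k , Mk = ∖-support (column x) i k Tk′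
      in i≢j , i≢k , j≢k , Mi , Mj , Mk
    common : ∀ i j k x y → x ≢ y → 1 ≤ triples (column x) i j k → 1 ≤ triples (column y) i j k → ⊥
    common i j k x y x≢y Tx Ty =
      let i≢j , i≢k , j≢k , ix , jx , kx = distinct x i j k Tx
          _ , _ , _ , iy , jy , ky = distinct y i j k Ty
      in free i j k x y i≢j i≢k j≢k x≢y ix jx kx iy jy ky

  -- In place of Cauchy-Schwarz, 2 (s a) n ≤ (s a)² + n² is summed over the paths, where a is the
  -- length minus one. With `squares` this gives 2 n s A ≤ 2 n² s² + p n² ≤ 6 n² s² for the sum A of
  -- all a.
  total≤-sqrt : ∀ s → 1 ≤ n → 1 ≤ s → p ≤ 4 * (s * s) → total ≤ p + 3 * (n * s)
  total≤-sqrt s 1≤n 1≤s p≤4s² = begin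
    total                                          ≤⟨ sum≤const+sum-∸ (λ i → sum (M i)) 1 ⟩
    p * 1 + A                                      ≤⟨ +-mono-≤ (≤-reflexive (*-identityʳ p)) A≤ ⟩
    p + 3 * (n * s)                                ∎
    where
    open ≤-Reasoning
    a : Fin p → ℕ
    a i = sum (M i) ∸ 1
    A = sum a
    instance
      nz : NonZero (2 * (n * s))
      nz = m*n≢0 2 (n * s) {{_}} {{m*n≢0 n s {{>-nonZero 1≤n}} {{>-nonZero 1≤s}}}}
    e₁ : ∀ n s a → 2 * (n * s) * a ≡ 2 * (s * a * n)
    e₁ = solve-∀
    e₂ : ∀ s a n → s * a * (s * a) + n * n ≡ s * s * (a * a) + n * n
    e₂ = solve-∀
    e₃ : ∀ n s → s * s * (n * (n * 2)) + 4 * (s * s) * (n * n) ≡ 2 * (n * s) * (3 * (n * s))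
    e₃ = solve-∀
    A≤ : A ≤ 3 * (n * s)
    A≤ = *-cancelˡ-≤ (2 * (n * s)) (begin
      2 * (n * s) * A                               ≡⟨ *-distribˡ-sum (2 * (n * s)) a ⟩
      sum (λ i → 2 * (n * s) * a i)                 ≤⟨ sum-mono (λ i → ≤-trans (≤-reflexive (e₁ n s (a i)))
                                                          (≤-trans (2ab≤a²+b² (s * a i) n) (≤-reflexive (e₂ s (a i) n)))) ⟩
      sum (λ i → s * s * (a i * a i) + n * n)       ≡⟨ ∑-distrib-+ (λ i → s * s * (a i * a i)) (λ _ → n * n) ⟩
      sum (λ i → s * s * (a i * a i)) + sum {p} (λ _ → n * n)
                                                    ≡⟨ cong₂ _+_ (sym (*-distribˡ-sum (s * s) (λ i → a i * a i))) (sum-const p (n * n)) ⟩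
      s * s * sum (λ i → a i * a i) + p * (n * n)   ≤⟨ +-mono-≤ (*-monoʳ-≤ (s * s) squares) (*-monoˡ-≤ (n * n) p≤4s²) ⟩
      s * s * (n * (n * 2)) + 4 * (s * s) * (n * n) ≡⟨ e₃ n s ⟩
      2 * (n * s) * (3 * (n * s))                   ∎)

  -- In place of Hölder's inequality, (a n) b² ≤ (a n)³ + b³ with b = t p is summed over the nodes,
  -- where a is the degree minus two. With `cubes` the right side is at most n³ p³ + n t³ p³ ≤ 9 n
  -- t³ p³.
  total≤-cbrt : ∀ t → 1 ≤ n → 1 ≤ p → 1 ≤ t → n * n ≤ 8 * (t * (t * t)) → total ≤ 2 * n + 9 * (t * p)
  total≤-cbrt t 1≤n 1≤p 1≤t n²≤8t³ = begin
    total                                          ≡⟨ total≡∑degree ⟩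
    sum degree                                     ≤⟨ sum≤const+sum-∸ degree 2 ⟩
    n * 2 + A                                      ≤⟨ +-mono-≤ (≤-reflexive (*-comm n 2)) A≤ ⟩
    2 * n + 9 * (t * p)                            ∎
    where
    open ≤-Reasoning
    a : Fin n → ℕ
    a x = degree x ∸ 2
    A = sum a
    b = t * p
    instance
      bz : NonZero b
      bz = m*n≢0 t p {{>-nonZero 1≤t}} {{>-nonZero 1≤p}}
      nz : NonZero (n * (b * b))
      nz = m*n≢0 n (b * b) {{>-nonZero 1≤n}} {{m*n≢0 b b}}
    e₁ : ∀ n b a → n * (b * b) * a ≡ a * n * (b * b)
    e₁ = solve-∀
    e₂ : ∀ n b a → a * n * (a * n * (a * n)) + b * (b * b) ≡ n * n * n * (a * (a * a)) + b * (b * b)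
    e₂ = solve-∀
    e₃ : ∀ n t p → n * n * n * (p * (p * (p * 1))) + n * (t * p * (t * p * (t * p)))
                   ≡ n * (p * (p * p)) * (n * n) + n * (p * (p * p)) * (t * (t * t))
    e₃ = solve-∀
    e₄ : ∀ n t p → n * (p * (p * p)) * (8 * (t * (t * t))) + n * (p * (p * p)) * (t * (t * t))
                   ≡ n * (t * p * (t * p)) * (9 * (t * p))
    e₄ = solve-∀
    A≤ : A ≤ 9 * (t * p)
    A≤ = *-cancelˡ-≤ (n * (b * b)) (begin
      n * (b * b) * A                                          ≡⟨ *-distribˡ-sum (n * (b * b)) a ⟩
      sum (λ x → n * (b * b) * a x)                            ≤⟨ sum-mono (λ x → ≤-trans (≤-reflexive (e₁ n b (a x)))
                                                                   (≤-trans (ab²≤a³+b³ (a x * n) b) (≤-reflexive (e₂ n b (a x))))) ⟩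
      sum (λ x → n * n * n * (a x * (a x * a x)) + b * (b * b)) ≡⟨ ∑-distrib-+ (λ x → n * n * n * (a x * (a x * a x))) (λ _ → b * (b * b)) ⟩
      sum (λ x → n * n * n * (a x * (a x * a x))) + sum {n} (λ _ → b * (b * b))
        ≡⟨ cong₂ _+_ (sym (*-distribˡ-sum (n * n * n) (λ x → a x * (a x * a x)))) (sum-const n (b * (b * b))) ⟩
      n * n * n * sum (λ x → a x * (a x * a x)) + n * (b * (b * b)) ≤⟨ +-monoˡ-≤ _ (*-monoʳ-≤ (n * n * n) cubes) ⟩
      n * n * n * (p * (p * (p * 1))) + n * (b * (b * b))      ≡⟨ e₃ n t p ⟩
      n * (p * (p * p)) * (n * n) + n * (p * (p * p)) * (t * (t * t)) ≤⟨ +-monoˡ-≤ _ (*-monoʳ-≤ (n * (p * (p * p))) n²≤8t³) ⟩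
      n * (p * (p * p)) * (8 * (t * (t * t))) + n * (p * (p * p)) * (t * (t * t)) ≡⟨ e₄ n t p ⟩
      n * (b * b) * (9 * (t * p))                              ∎)

-- Path systems of bridge girth greater than two

⟦_⟧ : ∀ {a} {A : Set a} → Dec A → ℕ
⟦ d ⟧ = if does d then 1 else 0

⟦⟧≤1 : ∀ {a} {A : Set a} (d : Dec A) → ⟦ d ⟧ ≤ 1
⟦⟧≤1 (yes _) = ≤-refl
⟦⟧≤1 (no  _) = z≤n

⟦⟧≥1⇒ : ∀ {a} {A : Set a} (d : Dec A) → 1 ≤ ⟦ d ⟧ → A
⟦⟧≥1⇒ (yes a) _ = a

infix 4 _∈?_
_∈?_ : ∀ {n} (x : Fin n) l → Dec (x ∈ l)
x ∈? l = Any.any? (x Fin.≟_) l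

sum-≡ : ∀ {n} (x : Fin n) → sum (λ y → ⟦ x Fin.≟ y ⟧) ≡ 1
sum-≡ {suc n} zero    = cong suc (trans (sum-const n 0) (*-zeroʳ n))
sum-≡ {suc n} (suc x) = sum-≡ x

-- This turns the size of a path system into the sum of the entries of its incidence matrix.
Unique⇒length≡sum : ∀ {n} {l : List (Fin n)} → Unique l → length l ≡ sum (λ x → ⟦ x ∈? l ⟧)
Unique⇒length≡sum {n} [] = sym (trans (sum-const n 0) (*-zeroʳ n))
Unique⇒length≡sum {n} {x ∷ l} (x∉ ∷ u) = begin
  1 + length l                                          ≡⟨ cong₂ _+_ (sym (sum-≡ x)) (Unique⇒length≡sum u) ⟩
  sum (λ y → ⟦ x Fin.≟ y ⟧) + sum (λ y → ⟦ y ∈? l ⟧)    ≡⟨ ∑-distrib-+ (λ y → ⟦ x Fin.≟ y ⟧) (λ y → ⟦ y ∈? l ⟧) ⟨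
  sum (λ y → ⟦ x Fin.≟ y ⟧ + ⟦ y ∈? l ⟧)                ≡⟨ sum-cong-≗ (λ y → sym (step y (y ∈? (x ∷ l)) (x Fin.≟ y) (y ∈? l))) ⟩
  sum (λ y → ⟦ y ∈? (x ∷ l) ⟧)                          ∎
  where
  open ≡-Reasoning
  step : ∀ y (d : Dec (y ∈ x ∷ l)) (e : Dec (x ≡ y)) (e′ : Dec (y ∈ l)) → ⟦ d ⟧ ≡ ⟦ e ⟧ + ⟦ e′ ⟧
  step y d         (yes refl) (yes y∈l) = contradiction y∈l (All¬⇒¬Any x∉)
  step y (yes _)   (yes refl) (no _)    = refl
  step y (no y∉)   (yes refl) (no _)    = contradiction (here refl) y∉
  step y (yes _)   (no _)     (yes _)   = refl
  step y (no y∉)   (no _)     (yes y∈l) = contradiction (there y∈l) y∉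
  step y (yes (here refl)) (no x≢y) (no _) = contradiction refl x≢y
  step y (yes (there y∈l)) (no _) (no y∉l) = contradiction y∈l y∉l
  step y (no _)    (no _)     (no _)    = refl

ListAction-sum : ∀ {p} (f : Fin p → ℕ) → ListAction.sum (map f (allFin p)) ≡ sum f
ListAction-sum f = trans (cong ListAction.sum (map-tabulate id f)) (sum-tabulate f)
  where
  sum-tabulate : ∀ {p} (f : Fin p → ℕ) → ListAction.sum (tabulate f) ≡ sum f
  sum-tabulate {zero}  f = refl
  sum-tabulate {suc p} f = cong (f zero +_) (sum-tabulate (f ∘ suc))

size≡sum : ∀ {n p} (S : PathSystem n p) → size S ≡ sum (λ i → length (path S i))
size≡sum S = ListAction-sum (λ i → length (path S i))

AllPairs-lookup : ∀ {a r} {A : Set a} {R : A → A → Set r} {l : List A} → AllPairs R l →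
  ∀ i j → i Fin.< j → R (List.lookup l i) (List.lookup l j)
AllPairs-lookup {l = _ ∷ l} (rs ∷ _) zero (suc j) _ = All.lookup rs (∈-lookup j)
AllPairs-lookup (_ ∷ ps) (suc i) (suc j) (s≤s i<j) = AllPairs-lookup ps i j i<j

-- Girth greater than 2 without mention of bridges or of the order of the paths, so that the ordered
-- and the unordered problem become one.
Reversing : ∀ {n p} → (Fin p → List (Fin n)) → Set
Reversing f = ∀ i j x y → i ≢ j → x ≢ y → Precedes (f i) x y → Precedes (f j) x y → ⊥

Precedes-irrefl : ∀ {n} {l : List (Fin n)} {x} → Unique l → ¬ Precedes l x x
Precedes-irrefl u (i , j , i<j , refl , eq) = AllPairs-lookup u i j i<j (sym eq)

module _ {n p} (S : PathSystem n p) where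

  twoBridge : ∀ {i j x y} → x ≢ y → i ≢ j → Precedes (path S i) x y → Precedes (path S j) x y → Bridge S 1
  twoBridge {i} {j} {x} {y} x≢y i≢j Pi Pj = record
    { v = λ { zero → x ; (suc zero) → y }
    ; π = λ { zero → i ; (suc zero) → j }
    ; v-inj = λ { {zero} {zero} _ → refl ; {zero} {suc zero} eq → contradiction eq x≢y
                ; {suc zero} {zero} eq → contradiction (sym eq) x≢y ; {suc zero} {suc zero} _ → refl }
    ; π-inj = λ { {zero} {zero} _ → refl ; {zero} {suc zero} eq → contradiction eq i≢j
                ; {suc zero} {zero} eq → contradiction (sym eq) i≢j ; {suc zero} {suc zero} _ → refl }
    ; arcs = λ { zero → Pi }
    ; river = Pj }

  reversing⇒girth : Reversing (path S) → GirthGt S 2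
  -- In a 1-bridge the node `v zero` would precede itself on the river.
  reversing⇒girth rev zero    _ B = Precedes-irrefl (unique S _) (Bridge.river B)
  reversing⇒girth rev (suc zero) _ B = rev (π zero) (π (suc zero)) (v zero) (v (suc zero))
    (λ eq → contradiction (π-inj eq) λ ()) (λ eq → contradiction (v-inj eq) λ ()) (arcs zero) river
    where open Bridge B
  reversing⇒girth rev (suc (suc b)) (s≤s (s≤s ()))

  girth⇒orderedGirth : ∀ {k} → GirthGt S k → OrderedGirthGt S k
  girth⇒orderedGirth gt b b<k B = gt b b<k (OrderedBridge.bridge B)

  -- The arc and the river of a 2-bridge play symmetric roles, so the later of the two paths can be
  -- taken as the river.
  orderedGirth⇒reversing : OrderedGirthGt S 2 → Reversing (path S)
  orderedGirth⇒reversing gt i j x y i≢j x≢y Pi Pj with Fin.<-cmp i j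
  ... | tri≈ _ i≡j _ = i≢j i≡j
  ... | tri< i<j _ _ = gt 1 ≤-refl (record { bridge = twoBridge x≢y i≢j Pi Pj ; order = λ { zero → i<j } })
  ... | tri> _ _ j<i = gt 1 ≤-refl (record { bridge = twoBridge x≢y (i≢j ∘ sym) Pj Pi ; order = λ { zero → j<i } })

  ∈-∈⇒Precedes : ∀ i x y → x ≢ y → x ∈ path S i → y ∈ path S i → Precedes (path S i) x y ⊎ Precedes (path S i) y x
  ∈-∈⇒Precedes i x y x≢y x∈ y∈ with Fin.<-cmp (Any.index x∈) (Any.index y∈)
  ... | tri< lt _ _ = inj₁ (_ , _ , lt , sym (lookup-index x∈) , sym (lookup-index y∈))
  ... | tri> _ _ gt = inj₂ (_ , _ , gt , sym (lookup-index y∈) , sym (lookup-index x∈))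
  ... | tri≈ _ eq _ = contradiction
    (trans (lookup-index x∈) (trans (cong (List.lookup (path S i)) eq) (sym (lookup-index y∈)))) x≢y

  module _ (rev : Reversing (path S)) where

    private
      incidence : Fin p → Fin n → ℕ
      incidence i x = ⟦ x ∈? path S i ⟧

      -- Pigeonhole: three paths, but only two orders of the two nodes.
      twoOrders : ∀ i j k x y → i ≢ j → i ≢ k → j ≢ k → x ≢ y →
        1 ≤ incidence i x → 1 ≤ incidence j x → 1 ≤ incidence k x →
        1 ≤ incidence i y → 1 ≤ incidence j y → 1 ≤ incidence k y → ⊥
      twoOrders i j k x y i≢j i≢k j≢k x≢y ix jx kx iy jy ky
        with on i ix iy | on j jx jy | on k kx ky
        where
        on : ∀ i → 1 ≤ incidence i x → 1 ≤ incidence i y → Precedes (path S i) x y ⊎ Precedes (path S i) y x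
        on i ix iy = ∈-∈⇒Precedes i x y x≢y (⟦⟧≥1⇒ (x ∈? path S i) ix) (⟦⟧≥1⇒ (y ∈? path S i) iy)
      ... | inj₁ P | inj₁ Q | _      = rev i j x y i≢j x≢y P Q
      ... | inj₁ P | inj₂ _ | inj₁ R = rev i k x y i≢k x≢y P R
      ... | inj₁ _ | inj₂ Q | inj₂ R = rev j k y x j≢k (x≢y ∘ sym) Q R
      ... | inj₂ P | inj₂ Q | _      = rev i j y x i≢j (x≢y ∘ sym) P Q
      ... | inj₂ P | inj₁ _ | inj₂ R = rev i k y x i≢k (x≢y ∘ sym) P R
      ... | inj₂ _ | inj₁ Q | inj₁ R = rev j k x y j≢k x≢y Q R

      open K₂₃-free incidence (λ i x → ⟦⟧≤1 (x ∈? path S i)) twoOrders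

      size≡total : size S ≡ total
      size≡total = trans (size≡sum S) (sum-cong-≗ λ i → Unique⇒length≡sum (unique S i))

    size≤-sqrt : ∀ s → 1 ≤ n → 1 ≤ s → p ≤ 4 * (s * s) → size S ≤ p + 3 * (n * s)
    size≤-sqrt s 1≤n 1≤s p≤ = subst (_≤ p + 3 * (n * s)) (sym size≡total) (total≤-sqrt s 1≤n 1≤s p≤)

    size≤-cbrt : ∀ t → 1 ≤ n → 1 ≤ p → 1 ≤ t → n * n ≤ 8 * (t * (t * t)) → size S ≤ 2 * n + 9 * (t * p)
    size≤-cbrt t 1≤n 1≤p 1≤t n²≤ = subst (_≤ 2 * n + 9 * (t * p)) (sym size≡total) (total≤-cbrt t 1≤n 1≤p 1≤t n²≤)

-- Integer roots and the upper bound

rootAux^≤ : ∀ k m r → 1 ≤ k → rootAux k m r ^ k ≤ m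
rootAux^≤ (suc k) m zero _ = z≤n
rootAux^≤ k m (suc r) 1≤k with suc r ^ k ≤? m
... | yes ≤m = ≤m
... | no  _  = rootAux^≤ k m r 1≤k

<rootAux^ : ∀ k m r → m < suc r ^ k → m < suc (rootAux k m r) ^ k
<rootAux^ k m zero    m< = m<
<rootAux^ k m (suc r) m< with suc r ^ k ≤? m
... | yes _ = m<
... | no ≰m = <rootAux^ k m r (≰⇒> ≰m)

root^≤ : ∀ k m → 1 ≤ k → root k m ^ k ≤ m
root^≤ k m = rootAux^≤ k m m

<root^ : ∀ k m → 1 ≤ k → m < suc (root k m) ^ k
<root^ k@(suc k-1) m _ = <rootAux^ k m m (m≤m*n (suc m) (suc m ^ k-1) {{m^n≢0 (suc m) k-1}})

1≤root : ∀ k m → 1 ≤ k → 1 ≤ m → 1 ≤ root k m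
1≤root k m 1≤k 1≤m with root k m | <root^ k m 1≤k
... | suc _ | _  = s≤s z≤n
... | zero  | m< = contradiction 1≤m (<⇒≱ (<-≤-trans m< (≤-reflexive (^-zeroˡ k))))

-- For r ≥ 1 one has r + 1 ≤ 2r, so rounding the root down costs only the constant factor 2^k.
≤2^*root^ : ∀ k m → 1 ≤ k → 1 ≤ m → m ≤ (2 * root k m) ^ k
≤2^*root^ k m 1≤k 1≤m = ≤-trans (<⇒≤ (<root^ k m 1≤k))
  (^-monoˡ-≤ k (+-mono-≤ (1≤root k m 1≤k 1≤m) (≤-reflexive (sym (+-identityʳ (root k m))))))

^2≡ : ∀ r → r ^ 2 ≡ r * r
^2≡ r = cong (r *_) (*-identityʳ r)

^3≡ : ∀ r → r ^ 3 ≡ r * (r * r)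
^3≡ r = cong (r *_) (^2≡ r)

root₂ : ∀ m → root 2 m * root 2 m ≤ m
root₂ m = subst (_≤ m) (^2≡ (root 2 m)) (root^≤ 2 m (s≤s z≤n))

root₃ : ∀ m → root 3 m * (root 3 m * root 3 m) ≤ m
root₃ m = subst (_≤ m) (^3≡ (root 3 m)) (root^≤ 3 m (s≤s z≤n))

≤4root₂ : ∀ m → 1 ≤ m → m ≤ 4 * (root 2 m * root 2 m)
≤4root₂ m 1≤m = ≤-trans (≤2^*root^ 2 m (s≤s z≤n) 1≤m) (≤-reflexive (expand (root 2 m)))
  where
  expand : ∀ s → (2 * s) * ((2 * s) * 1) ≡ 4 * (s * s)
  expand = solve-∀

≤8root₃ : ∀ m → 1 ≤ m → m ≤ 8 * (root 3 m * (root 3 m * root 3 m))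
≤8root₃ m 1≤m = ≤-trans (≤2^*root^ 3 m (s≤s z≤n) 1≤m) (≤-reflexive (expand (root 3 m)))
  where
  expand : ∀ s → (2 * s) * ((2 * s) * ((2 * s) * 1)) ≡ 8 * (s * (s * s))
  expand = solve-∀

-- The minimum equals one of its two arguments, and the count belonging to that argument is used.
-- The factor 9 comes from the count of triples.
size≤bound : ∀ {n p} (S : PathSystem n p) → Reversing (path S) → 1 ≤ n → 1 ≤ p → size S ≤ 9 * bound n p
size≤bound {n} {p} S rev 1≤n 1≤p with ⊓-sel (n * root 2 p) (root 3 (n ^ 2) * p)
... | inj₁ eq = begin
  size S                      ≤⟨ size≤-sqrt S rev s 1≤n (1≤root 2 p (s≤s z≤n) 1≤p) (≤4root₂ p 1≤p) ⟩
  p + 3 * (n * s)             ≤⟨ m≤m+n _ (6 * (n * s) + 9 * n + 8 * p) ⟩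
  p + 3 * (n * s) + (6 * (n * s) + 9 * n + 8 * p) ≡⟨ collect p (n * s) n ⟩
  9 * (n * s + n + p)         ≡⟨ cong (λ u → 9 * (u + n + p)) eq ⟨
  9 * bound n p               ∎
  where
  open ≤-Reasoning
  s = root 2 p
  collect : ∀ p x n → p + 3 * x + (6 * x + 9 * n + 8 * p) ≡ 9 * (x + n + p)
  collect = solve-∀
... | inj₂ eq = begin
  size S                      ≤⟨ size≤-cbrt S rev t 1≤n 1≤p (1≤root 3 (n ^ 2) (s≤s z≤n) 1≤n²) n²≤8t³ ⟩
  2 * n + 9 * (t * p)         ≤⟨ m≤m+n _ (7 * n + 9 * p) ⟩
  2 * n + 9 * (t * p) + (7 * n + 9 * p) ≡⟨ collect p (t * p) n ⟩
  9 * (t * p + n + p)         ≡⟨ cong (λ u → 9 * (u + n + p)) eq ⟨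
  9 * bound n p               ∎
  where
  open ≤-Reasoning
  t = root 3 (n ^ 2)
  1≤n² : 1 ≤ n ^ 2
  1≤n² = m^n>0 n {{>-nonZero 1≤n}} 2
  n²≤8t³ : n * n ≤ 8 * (t * (t * t))
  n²≤8t³ = subst (_≤ 8 * (t * (t * t))) (^2≡ n) (≤8root₃ (n ^ 2) 1≤n²)
  collect : ∀ p x n → 2 * n + 9 * x + (7 * n + 9 * p) ≡ 9 * (x + n + p)
  collect = solve-∀

-- Existence of a largest reversing system

allLists : ∀ n → ℕ → List (List (Fin n))
allLists n zero    = [] ∷ []
allLists n (suc k) = [] ∷ cartesianProductWith _∷_ (allFin n) (allLists n k)

∈-allLists : ∀ {n} k (l : List (Fin n)) → length l ≤ k → l ∈ allLists n k
∈-allLists zero    []      _ = here refl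
∈-allLists (suc k) []      _ = here refl
∈-allLists (suc k) (x ∷ l) (s≤s ≤k) = there (∈-cartesianProductWith⁺ _∷_ (∈-allFin x) (∈-allLists k l ≤k))

allVecs : ∀ {A : Set} → List A → ∀ p → List (Vec A p)
allVecs xs zero    = [] ∷ []
allVecs xs (suc p) = cartesianProductWith _∷_ xs (allVecs xs p)

∈-allVecs : ∀ {A : Set} {xs : List A} {p} (f : Fin p → A) → (∀ i → f i ∈ xs) → Vec.tabulate f ∈ allVecs xs p
∈-allVecs {p = zero}  f f∈ = here refl
∈-allVecs {p = suc p} f f∈ = ∈-cartesianProductWith⁺ _∷_ (f∈ zero) (∈-allVecs (f ∘ suc) (f∈ ∘ suc))

Unique⇒length≤ : ∀ {n} {l : List (Fin n)} → Unique l → length l ≤ n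
Unique⇒length≤ {n} {l} u = begin
  length l                   ≡⟨ Unique⇒length≡sum u ⟩
  sum (λ x → ⟦ x ∈? l ⟧)     ≤⟨ sum-mono (λ x → ⟦⟧≤1 (x ∈? l)) ⟩
  sum {n} (λ _ → 1)          ≡⟨ sum-const n 1 ⟩
  n * 1                      ≡⟨ *-identityʳ n ⟩
  n                          ∎
  where open ≤-Reasoning

Precedes? : ∀ {n} (l : List (Fin n)) x y → Dec (Precedes l x y)
Precedes? l x y = Fin.any? λ i → Fin.any? λ j →
  (i Fin.<? j) ×-dec (List.lookup l i Fin.≟ x) ×-dec (List.lookup l j Fin.≟ y)

Valid : ∀ {n p} → (Fin p → List (Fin n)) → Set
Valid f = (∀ i → Unique (f i)) × Reversing f

valid? : ∀ {n p} (f : Fin p → List (Fin n)) → Dec (Valid f)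
valid? f = Fin.all? (λ i → unique? Fin._≟_ (f i)) ×-dec
  Fin.all? λ i → Fin.all? λ j → Fin.all? λ x → Fin.all? λ y →
    ¬? (i Fin.≟ j) →-dec ¬? (x Fin.≟ y) →-dec Precedes? (f i) x y →-dec ¬? (Precedes? (f j) x y)

Valid-cong : ∀ {n p} {f g : Fin p → List (Fin n)} → (∀ i → f i ≡ g i) → Valid f → Valid g
Valid-cong eq (u , rev) = (λ i → subst Unique (eq i) (u i)) , λ i j x y i≢j x≢y Pi Pj →
  rev i j x y i≢j x≢y (subst (λ l → Precedes l x y) (sym (eq i)) Pi) (subst (λ l → Precedes l x y) (sym (eq j)) Pj)

-- Exhaustive search: a path without repetition has at most `n` nodes, so finitely many families
-- need to be listed. They are listed as vectors, since functions that agree pointwise need not be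
-- propositionally equal.
largestReversing : ∀ n p → Σ (PathSystem n p) λ S → Reversing (path S) ×
  (∀ (T : PathSystem n p) → Reversing (path T) → size T ≤ size S)
largestReversing n p = S , proj₂ best-valid , largest
  where
  weight : Vec (List (Fin n)) p → ℕ
  weight v = sum λ i → length (Vec.lookup v i)
  V? : Decidable (λ (v : Vec (List (Fin n)) p) → Valid (Vec.lookup v))
  V? v = valid? (Vec.lookup v)
  candidates = filter V? (allVecs (allLists n n) p)
  -- The default value, a family of empty paths, is itself valid, so `best` is valid in every case.
  best = argmax weight (Vec.replicate p []) candidates
  best-valid : Valid (Vec.lookup best)
  best-valid = argmax-all weight {P = λ v → Valid (Vec.lookup v)}
    (Valid-cong (λ i → sym (lookup-replicate i [])) ((λ _ → []) , λ { _ _ _ _ _ _ (() , _) _ }))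
    (all-filter V? (allVecs (allLists n n) p))
  S : PathSystem n p
  S = record { path = Vec.lookup best ; unique = proj₁ best-valid }
  largest : ∀ T → Reversing (path T) → size T ≤ size S
  largest T rev = begin
    size T                           ≡⟨ size≡sum T ⟩
    sum (λ i → length (path T i))    ≡⟨ sum-cong-≗ (λ i → cong length (sym (lookup∘tabulate (path T) i))) ⟩
    weight (Vec.tabulate (path T))   ≤⟨ All.lookup (f[xs]≤f[argmax] {f = weight} (Vec.replicate p []) candidates)
      (∈-filter⁺ V? (∈-allVecs (path T) λ i → ∈-allLists n (path T i) (Unique⇒length≤ (unique T i)))
        (Valid-cong (λ i → sym (lookup∘tabulate (path T) i)) (unique T , rev))) ⟩
    weight best                      ≡⟨ size≡sum S ⟨
    size S                           ∎
    where open ≤-Reasoning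

-- Quadratics modulo a prime

module _ (q : ℕ) .{{_ : NonZero q}} where

  -- Congruences are moved to the integers, where differences are not truncated.
  %≡⇒∣- : ∀ m n → m % q ≡ n % q → pos q ℤ.∣ pos n ℤ.- pos m
  %≡⇒∣- m n eq = ℤ.divides (pos (n / q) ℤ.- pos (m / q)) (begin
    pos n ℤ.- pos m
      ≡⟨ cong₂ ℤ._-_ (split n) (split m) ⟩
    (pos (n % q) ℤ.+ pos (n / q) ℤ.* pos q) ℤ.- (pos (m % q) ℤ.+ pos (m / q) ℤ.* pos q)
      ≡⟨ cong (λ u → (pos (n % q) ℤ.+ pos (n / q) ℤ.* pos q) ℤ.- (pos u ℤ.+ pos (m / q) ℤ.* pos q)) eq ⟩
    (pos (n % q) ℤ.+ pos (n / q) ℤ.* pos q) ℤ.- (pos (n % q) ℤ.+ pos (m / q) ℤ.* pos q)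
      ≡⟨ ring (pos (n % q)) (pos (n / q)) (pos (m / q)) (pos q) ⟩
    (pos (n / q) ℤ.- pos (m / q)) ℤ.* pos q ∎)
    where
    open ≡-Reasoning
    split : ∀ n → pos n ≡ pos (n % q) ℤ.+ pos (n / q) ℤ.* pos q
    split n = trans (cong pos (m≡m%n+[m/n]*n n q))
      (trans (ℤ.pos-+ (n % q) (n / q * q)) (cong (ℤ._+_ (pos (n % q))) (ℤ.pos-* (n / q) q)))
    ring : ∀ r a b q → (r ℤ.+ a ℤ.* q) ℤ.- (r ℤ.+ b ℤ.* q) ≡ (a ℤ.- b) ℤ.* q
    ring = ℤSolver.solve-∀

  ∣∸⇒≡ : ∀ {a b} → b < q → a ≤ b → q ∣ b ∸ a → a ≡ b
  ∣∸⇒≡ {a} {b} b<q a≤b d with b ∸ a in eq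
  ... | zero  = ≤-antisym a≤b (m∸n≡0⇒m≤n eq)
  ... | suc k = contradiction d (>⇒∤ (≤-<-trans (≤-trans (≤-reflexive (sym eq)) (m∸n≤m b a)) b<q))

  ∣-small⇒≡ : ∀ {a b} → a < q → b < q → pos q ℤ.∣ pos a ℤ.- pos b → a ≡ b
  ∣-small⇒≡ {a} {b} a<q b<q q∣ with ≤-total a b
  ... | inj₁ a≤b = ∣∸⇒≡ b<q a≤b (subst (q ∣_) (trans (cong ℤ.∣_∣ (ℤ.[+m]-[+n]≡m⊖n a b)) (ℤ.∣⊖∣-≤ a≤b)) (ℤ.∣⇒∣ᵤ q∣))
  ... | inj₂ b≤a = sym (∣∸⇒≡ a<q b≤a (subst (q ∣_)
      (trans (cong ℤ.∣_∣ (ℤ.[+m]-[+n]≡m⊖n a b)) (trans (ℤ.∣m⊖n∣≡∣n⊖m∣ a b) (ℤ.∣⊖∣-≤ b≤a))) (ℤ.∣⇒∣ᵤ q∣)))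

euclidsLemmaℤ : ∀ {q} → Prime q → ∀ i j → pos q ℤ.∣ i ℤ.* j → pos q ℤ.∣ i ⊎ pos q ℤ.∣ j
euclidsLemmaℤ {q} pr i j d with euclidsLemma ℤ.∣ i ∣ ℤ.∣ j ∣ pr (subst (q ∣_) (ℤ.abs-* i j) (ℤ.∣⇒∣ᵤ d))
... | inj₁ q∣i = inj₁ (ℤ.∣ᵤ⇒∣ q∣i)
... | inj₂ q∣j = inj₂ (ℤ.∣ᵤ⇒∣ q∣j)

-- The quadratic x + yτ + zτ² and its derivative at τ = t.
value : ℕ → ℕ → ℕ → ℕ → ℕ
value t x y z = x + t * y + t * t * z

slope : ℕ → ℕ → ℕ → ℕ
slope t y z = y + 2 * t * z

module _ {q : ℕ} .{{_ : NonZero q}} (pr : Prime q) (2<q : 2 < q) where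

  private
    valueℤ : ℤ → ℤ → ℤ → ℤ → ℤ
    valueℤ t x y z = x ℤ.+ t ℤ.* y ℤ.+ t ℤ.* t ℤ.* z

    slopeℤ : ℤ → ℤ → ℤ → ℤ
    slopeℤ t y z = y ℤ.+ pos 2 ℤ.* t ℤ.* z

    value-cast : ∀ t x y z → pos (value t x y z) ≡ valueℤ (pos t) (pos x) (pos y) (pos z)
    value-cast t x y z = trans (ℤ.pos-+ (x + t * y) (t * t * z)) (cong₂ ℤ._+_
      (trans (ℤ.pos-+ x (t * y)) (cong (ℤ._+_ (pos x)) (ℤ.pos-* t y)))
      (trans (ℤ.pos-* (t * t) z) (cong (ℤ._* (pos z)) (ℤ.pos-* t t))))

    slope-cast : ∀ t y z → pos (slope t y z) ≡ slopeℤ (pos t) (pos y) (pos z)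
    slope-cast t y z = trans (ℤ.pos-+ y (2 * t * z)) (cong (ℤ._+_ (pos y))
      (trans (ℤ.pos-* (2 * t) z) (cong (ℤ._* (pos z)) (ℤ.pos-* 2 t))))

    -- The value is linear in the coefficients, so the difference D of the two quadratics vanishes
    -- at `t` modulo `q`.
    values : ∀ t x y z x′ y′ z′ → value t x y z % q ≡ value t x′ y′ z′ % q →
      pos q ℤ.∣ valueℤ (pos t) (pos x′ ℤ.- pos x) (pos y′ ℤ.- pos y) (pos z′ ℤ.- pos z)
    values t x y z x′ y′ z′ eq = subst (pos q ℤ.∣_)
      (trans (cong₂ ℤ._-_ (value-cast t x′ y′ z′) (value-cast t x y z)) (linear (pos t) (pos x) (pos y) (pos z) (pos x′) (pos y′) (pos z′)))
      (%≡⇒∣- q (value t x y z) (value t x′ y′ z′) eq)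
      where
      linear : ∀ t x y z x′ y′ z′ → (x′ ℤ.+ t ℤ.* y′ ℤ.+ t ℤ.* t ℤ.* z′) ℤ.- (x ℤ.+ t ℤ.* y ℤ.+ t ℤ.* t ℤ.* z)
        ≡ (x′ ℤ.- x) ℤ.+ t ℤ.* (y′ ℤ.- y) ℤ.+ t ℤ.* t ℤ.* (z′ ℤ.- z)
      linear = ℤSolver.solve-∀

    -- By the same linearity, D′(t) is congruent to the difference of the two residues that
    -- determine the order on the path.
    slopes : ∀ t y z y′ z′ → pos q ℤ.∣ slopeℤ (pos t) (pos y′ ℤ.- pos y) (pos z′ ℤ.- pos z) ℤ.- (pos (slope t y′ z′ % q) ℤ.- pos (slope t y z % q))
    slopes t y z y′ z′ = subst (pos q ℤ.∣_)
      (trans (cong₂ (λ u v → (u ℤ.- pos r′) ℤ.- (v ℤ.- pos r)) (slope-cast t y′ z′) (slope-cast t y z))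
        (linear (pos t) (pos y) (pos z) (pos y′) (pos z′) (pos r) (pos r′)))
      (ℤ.∣m∣n⇒∣m-n (residue (slope t y′ z′)) (residue (slope t y z)))
      where
      r = slope t y z % q
      r′ = slope t y′ z′ % q
      residue : ∀ m → pos q ℤ.∣ pos m ℤ.- pos (m % q)
      residue m = %≡⇒∣- q (m % q) m (m%n%n≡m%n m q)
      linear : ∀ t y z y′ z′ r r′ → ((y′ ℤ.+ pos 2 ℤ.* t ℤ.* z′) ℤ.- r′) ℤ.- ((y ℤ.+ pos 2 ℤ.* t ℤ.* z) ℤ.- r)
        ≡ ((y′ ℤ.- y) ℤ.+ pos 2 ℤ.* t ℤ.* (z′ ℤ.- z)) ℤ.- (r′ ℤ.- r)
      linear = ℤSolver.solve-∀

    q∤2 : ¬ (pos q ℤ.∣ pos 2)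
    q∤2 d = >⇒∤ 2<q (ℤ.∣⇒∣ᵤ d)

    q∤- : ∀ {t s} → t < q → s < q → t ≢ s → ¬ (pos q ℤ.∣ pos t ℤ.- pos s)
    q∤- t<q s<q t≢s d = t≢s (∣-small⇒≡ q t<q s<q d)

  -- If D has degree at most two and D(t) ≡ D(s), then (t − s)(D′(t) + D′(s)) ≡ 0,
  -- so D′(t) ≡ −D′(s).
  slopes-opposite : ∀ {x y z x′ y′ z′ t s} → x < q → x′ < q → y < q → y′ < q → z < q → z′ < q →
    t < q → s < q → t ≢ s →
    value t x y z % q ≡ value t x′ y′ z′ % q → value s x y z % q ≡ value s x′ y′ z′ % q →
    slope t y z % q ≤ slope t y′ z′ % q → slope s y z % q ≤ slope s y′ z′ % q →
    slope t y′ z′ % q + slope s y′ z′ % q < q →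
    x ≡ x′ × y ≡ y′ × z ≡ z′
  slopes-opposite {x} {y} {z} {x′} {y′} {z′} {t} {s} x< x′< y< y′< z< z′< t< s< t≢s vt vs rt≤ rs≤ small =
    x≡x′ , y≡y′ , z≡z′
    where
    T = pos t
    S = pos s
    X = pos x′ ℤ.- pos x
    Y = pos y′ ℤ.- pos y
    Z = pos z′ ℤ.- pos z
    rt = slope t y z % q
    rt′ = slope t y′ z′ % q
    rs = slope s y z % q
    rs′ = slope s y′ z′ % q
    A = pos rt′ ℤ.- pos rt
    B = pos rs′ ℤ.- pos rs

    -- The trapezoidal rule is exact here: 2(D(t) - D(s)) = (t - s)(D′(t) + D′(s)). The numbers `a`
    -- and `b` stand for the residues of the derivatives.
    trapezoid : ∀ t s x y z a b →
      pos 2 ℤ.* ((x ℤ.+ t ℤ.* y ℤ.+ t ℤ.* t ℤ.* z) ℤ.- (x ℤ.+ s ℤ.* y ℤ.+ s ℤ.* s ℤ.* z))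
        ℤ.- (t ℤ.- s) ℤ.* (((y ℤ.+ pos 2 ℤ.* t ℤ.* z) ℤ.- a) ℤ.+ ((y ℤ.+ pos 2 ℤ.* s ℤ.* z) ℤ.- b))
      ≡ (t ℤ.- s) ℤ.* (a ℤ.+ b)
    trapezoid = ℤSolver.solve-∀

    q∣product : pos q ℤ.∣ (T ℤ.- S) ℤ.* (A ℤ.+ B)
    q∣product = subst (pos q ℤ.∣_) (trapezoid T S X Y Z A B)
      (ℤ.∣m∣n⇒∣m-n
        (ℤ.∣n⇒∣m*n (pos 2) (ℤ.∣m∣n⇒∣m-n (values t x y z x′ y′ z′ vt) (values s x y z x′ y′ z′ vs)))
        (ℤ.∣n⇒∣m*n (T ℤ.- S) (ℤ.∣m∣n⇒∣m+n (slopes t y z y′ z′) (slopes s y z y′ z′))))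

    rise : ∀ {a b} → a ≤ b → pos b ℤ.- pos a ≡ pos (b ∸ a)
    rise {a} {b} a≤b = trans (ℤ.[+m]-[+n]≡m⊖n b a) (ℤ.⊖-≥ a≤b)

    vanish : ∀ k → k < q → q ∣ k → k ≡ 0
    vanish zero    _ _ = refl
    vanish (suc k) k<q d = contradiction d (>⇒∤ k<q)

    -- Since t ≠ s, `q` divides the sum of the two rises; both are natural numbers and their sum is
    -- below `q`, so it is 0.
    rises≡0 : (rt′ ∸ rt) + (rs′ ∸ rs) ≡ 0
    rises≡0 = [ (λ d → contradiction d (q∤- t< s< t≢s))
              , (λ d → vanish _ (≤-<-trans (+-mono-≤ (m∸n≤m rt′ rt) (m∸n≤m rs′ rs)) small)
                  (ℤ.∣⇒∣ᵤ (subst (pos q ℤ.∣_) (trans (cong₂ ℤ._+_ (rise rt≤) (rise rs≤)) (sym (ℤ.pos-+ (rt′ ∸ rt) (rs′ ∸ rs)))) d)))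
              ]′ (euclidsLemmaℤ pr (T ℤ.- S) (A ℤ.+ B) q∣product)

    flat : ∀ {u a b} → a ≤ b → b ∸ a ≡ 0 → pos q ℤ.∣ u ℤ.- (pos b ℤ.- pos a) → pos q ℤ.∣ u
    flat {u} a≤b eq = subst (pos q ℤ.∣_) (trans (cong (λ v → u ℤ.- v) (trans (rise a≤b) (cong pos eq))) (ℤ.+-identityʳ u))

    qₜ : pos q ℤ.∣ slopeℤ T Y Z
    qₜ = flat rt≤ (m+n≡0⇒m≡0 (rt′ ∸ rt) rises≡0) (slopes t y z y′ z′)

    qₛ : pos q ℤ.∣ slopeℤ S Y Z
    qₛ = flat rs≤ (m+n≡0⇒n≡0 (rt′ ∸ rt) rises≡0) (slopes s y z y′ z′)

    slopes-differ : ∀ t s y z → (y ℤ.+ pos 2 ℤ.* t ℤ.* z) ℤ.- (y ℤ.+ pos 2 ℤ.* s ℤ.* z) ≡ (pos 2 ℤ.* (t ℤ.- s)) ℤ.* z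
    slopes-differ = ℤSolver.solve-∀

    -- Now D′ vanishes at both points, and D′(t) - D′(s) is 2(t - s) times the leading coefficient;
    -- the other coefficients follow by back substitution.
    q∣z : pos q ℤ.∣ Z
    q∣z = [ (λ d → [ (λ d₂ → contradiction d₂ q∤2) , (λ d₃ → contradiction d₃ (q∤- t< s< t≢s)) ]′
                     (euclidsLemmaℤ pr (pos 2) (T ℤ.- S) d))
          , (λ d → d)
          ]′ (euclidsLemmaℤ pr (pos 2 ℤ.* (T ℤ.- S)) Z (subst (pos q ℤ.∣_) (slopes-differ T S Y Z) (ℤ.∣m∣n⇒∣m-n qₜ qₛ)))

    q∣y : pos q ℤ.∣ Y
    q∣y = ℤ.∣m+n∣n⇒∣m qₜ (ℤ.∣n⇒∣m*n (pos 2 ℤ.* T) q∣z)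

    q∣x : pos q ℤ.∣ X
    q∣x = ℤ.∣m+n∣n⇒∣m (ℤ.∣m+n∣n⇒∣m (values t x y z x′ y′ z′ vt) (ℤ.∣n⇒∣m*n (T ℤ.* T) q∣z)) (ℤ.∣n⇒∣m*n T q∣y)

    x≡x′ = sym (∣-small⇒≡ q x′< x< q∣x)
    y≡y′ = sym (∣-small⇒≡ q y′< y< q∣y)
    z≡z′ = sym (∣-small⇒≡ q z′< z< q∣z)

  affine-injective : ∀ a b → ¬ (pos q ℤ.∣ pos a) → ∀ {k l} → k < q → l < q → (b + a * k) % q ≡ (b + a * l) % q → k ≡ l
  affine-injective a b q∤a {k} {l} k<q l<q eq
    with euclidsLemmaℤ pr (pos a) (pos l ℤ.- pos k)
      (subst (pos q ℤ.∣_) (trans (cong₂ ℤ._-_ (cast l) (cast k)) (ring (pos a) (pos b) (pos k) (pos l)))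
        (%≡⇒∣- q (b + a * k) (b + a * l) eq))
    where
    cast : ∀ k → pos (b + a * k) ≡ pos b ℤ.+ pos a ℤ.* pos k
    cast k = trans (ℤ.pos-+ b (a * k)) (cong (ℤ._+_ (pos b)) (ℤ.pos-* a k))
    ring : ∀ a b k l → (b ℤ.+ a ℤ.* l) ℤ.- (b ℤ.+ a ℤ.* k) ≡ a ℤ.* (l ℤ.- k)
    ring = ℤSolver.solve-∀
  ... | inj₁ d = contradiction d q∤a
  ... | inj₂ d = sym (∣-small⇒≡ q l<q k<q d)

-- A spanning path, and systems sorted by a rank

spanningSystem : ∀ n p → PathSystem (suc n) (suc p)
spanningSystem n p = record
  { path   = λ { zero → allFin (suc n) ; (suc _) → zero ∷ [] }
  ; unique = λ { zero → Unique.allFin⁺ (suc n) ; (suc _) → [] ∷ [] } }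

spanningSystem-reversing : ∀ n p → Reversing (path (spanningSystem n p))
spanningSystem-reversing n p zero    zero    x y i≢j _ _ _ = i≢j refl
spanningSystem-reversing n p (suc i) _       x y _ _ (zero , zero , () , _) _
spanningSystem-reversing n p zero    (suc j) x y _ _ _ (zero , zero , () , _)

size-spanningSystem : ∀ n p → size (spanningSystem n p) ≡ suc n + p
size-spanningSystem n p = trans (size≡sum (spanningSystem n p))
  (cong₂ _+_ (length-tabulate {n = suc n} (λ i → i)) (trans (sum-const p 1) (*-identityʳ p)))

-- Each path lists its incident nodes by increasing rank. Ranks may coincide, so `Precedes⇒` yields
-- only a weak inequality.
module SortedSystem {n p} {Inc : Fin p → Fin n → Set} (inc? : ∀ i x → Dec (Inc i x)) (rank : Fin p → Fin n → ℕ) where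

  private
    order : Fin p → DecTotalOrder _ _ _
    order i = On.decTotalOrder ≤-decTotalOrder (rank i)
    module O i = Sort (order i)
    nodes : Fin p → List (Fin n)
    nodes i = filter (inc? i) (allFin n)

  system : PathSystem n p
  system = record
    { path   = λ i → O.sort i (nodes i)
    ; unique = λ i → Permutationₛ.Unique-resp-↭ (setoid (Fin n)) (↭⇒↭ₛ (↭-sym (O.sort-↭ i (nodes i))))
                       (Unique.filter⁺ (inc? i) (Unique.allFin⁺ n)) }

  ∈⇒Inc : ∀ i {x} → x ∈ path system i → Inc i x
  ∈⇒Inc i x∈ = proj₂ (∈-filter⁻ (inc? i) {xs = allFin n} (∈-resp-↭ (O.sort-↭ i (nodes i)) x∈))

  Inc⇒∈ : ∀ i {x} → Inc i x → x ∈ path system i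
  Inc⇒∈ i {x} inc = ∈-resp-↭ (↭-sym (O.sort-↭ i (nodes i))) (∈-filter⁺ (inc? i) (∈-allFin x) inc)

  Precedes⇒ : ∀ i {x y} → Precedes (path system i) x y → Inc i x × Inc i y × rank i x ≤ rank i y
  Precedes⇒ i (a , b , a<b , refl , refl) = ∈⇒Inc i (∈-lookup a) , ∈⇒Inc i (∈-lookup b) ,
    AllPairs-lookup (Sorted⇒AllPairs (DecTotalOrder.totalOrder (order i)) (O.sort-↗ i (nodes i))) a b a<b

  size-system : size system ≡ sum λ i → sum λ x → ⟦ inc? i x ⟧
  size-system = trans (size≡sum system) (sum-cong-≗ λ i → trans (Unique⇒length≡sum (unique system i))
    (sum-cong-≗ λ x → same i x (x ∈? path system i) (inc? i x)))
    where
    same : ∀ i x (d : Dec (x ∈ path system i)) (e : Dec (Inc i x)) → ⟦ d ⟧ ≡ ⟦ e ⟧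
    same i x (yes _)  (yes _)  = refl
    same i x (no _)   (no _)   = refl
    same i x (yes x∈) (no ¬i)  = contradiction (∈⇒Inc i x∈) ¬i
    same i x (no x∉)  (yes i₁) = contradiction (Inc⇒∈ i i₁) x∉

-- Sums over prefixes, digits and permuted indices

sum-prefix : ∀ {m n} (f : ℕ → ℕ) → m ≤ n → sum {m} (f ∘ toℕ) ≤ sum {n} (f ∘ toℕ)
sum-prefix f z≤n       = z≤n
sum-prefix f (s≤s m≤n) = +-monoʳ-≤ (f 0) (sum-prefix (f ∘ suc) m≤n)

sum-+ : ∀ m n (f : ℕ → ℕ) → sum {m + n} (f ∘ toℕ) ≡ sum {m} (f ∘ toℕ) + sum {n} (λ k → f (m + toℕ k))
sum-+ zero    n f = refl
sum-+ (suc m) n f = trans (cong (f 0 +_) (sum-+ m n (f ∘ suc))) (sym (+-assoc (f 0) _ _))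

-- Every index below `a * b` is written in base `b` with last digit j and leading part i.
sum-digits : ∀ a b (f : ℕ → ℕ) → sum {a * b} (f ∘ toℕ) ≡ sum {a} (λ i → sum {b} λ j → f (toℕ j + toℕ i * b))
sum-digits zero    b f = refl
sum-digits (suc a) b f = trans (sum-+ b (a * b) f) (cong₂ _+_
  (sum-cong-≗ {b} λ j → cong f (sym (+-identityʳ (toℕ j))))
  (trans (sum-digits a b (λ k → f (b + k))) (sum-cong-≗ {a} λ i → sum-cong-≗ {b} λ j → cong f (swap b (toℕ j) (toℕ i * b)))))
  where
  swap : ∀ b j k → b + (j + k) ≡ j + (b + k)
  swap = solve-∀

term≤sum : ∀ {n} (f : Fin n → ℕ) i → f i ≤ sum f
term≤sum f i = ≤-trans (m≤n+m (f i) (sum (f ∖ i))) (≤-reflexive (sum-∖ f i))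

sum-≥ : ∀ {n} (f : Fin n → ℕ) c → (∀ i → c ≤ f i) → n * c ≤ sum f
sum-≥ {n} f c c≤ = ≤-trans (≤-reflexive (sym (sum-const n c))) (sum-mono c≤)

-- The minimum covers both a family cut down to `n` members and one continued beyond the `b` members
-- that satisfy the bound.
sum-prefix-≥ : ∀ n b c (f : ℕ → ℕ) → (∀ i → i < b → c ≤ f i) → (n ⊓ b) * c ≤ sum {n} (f ∘ toℕ)
sum-prefix-≥ n b c f c≤ = ≤-trans
  (sum-≥ {n ⊓ b} (f ∘ toℕ) c (λ i → c≤ (toℕ i) (<-≤-trans (Fin.toℕ<n i) (m⊓n≤n n b))))
  (sum-prefix f (m⊓n≤m n b))

-- Punching out a missed value would inject a finite set into a smaller one.
injective⇒surjective : ∀ {n} (f : Fin n → Fin n) → Injective _≡_ _≡_ f → ∀ y → ∃ λ x → f x ≡ y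
injective⇒surjective {suc n} f inj y with Fin.any? (λ x → f x Fin.≟ y)
... | yes hit = hit
... | no miss = contradiction (Fin.injective⇒≤ {f = λ x → Fin.punchOut (avoid x)}
      (λ eq → inj (Fin.punchOut-injective (avoid _) (avoid _) eq))) 1+n≰n
  where
  avoid : ∀ x → y ≢ f x
  avoid x eq = miss (x , sym eq)

sum-injective : ∀ {n} (f : Fin n → Fin n) → Injective _≡_ _≡_ f → ∀ (g : Fin n → ℕ) → sum g ≡ sum (g ∘ f)
sum-injective f inj g = sum-permute g (permutation f (proj₁ ∘ surj) (proj₂ ∘ surj) (λ x → inj (proj₂ (surj (f x)))))
  where surj = injective⇒surjective f inj

⟦⟧-mono : ∀ {a b} {A : Set a} {B : Set b} (d : Dec A) (e : Dec B) → (A → B) → ⟦ d ⟧ ≤ ⟦ e ⟧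
⟦⟧-mono (no _)  e       f = z≤n
⟦⟧-mono (yes _) (yes _) f = ≤-refl
⟦⟧-mono (yes a) (no ¬b) f = contradiction (f a) ¬b

⟦⟧-× : ∀ {a b} {A : Set a} {B : Set b} (d : Dec A) (e : Dec B) → ⟦ d ×-dec e ⟧ ≡ ⟦ d ⟧ * ⟦ e ⟧
⟦⟧-× (no _)  e       = refl
⟦⟧-× (yes _) (yes _) = refl
⟦⟧-× (yes _) (no _)  = refl

⟦⟧-yes : ∀ {a} {A : Set a} (d : Dec A) → A → 1 ≤ ⟦ d ⟧
⟦⟧-yes (yes _) a = ≤-refl
⟦⟧-yes (no ¬a) a = contradiction a ¬a

digit-% : ∀ q .{{_ : NonZero q}} {x} u → x < q → (x + u * q) % q ≡ x
digit-% q {x} u x<q = trans ([m+kn]%n≡m%n x u q) (m<n⇒m%n≡m x<q)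

digit-/ : ∀ q .{{_ : NonZero q}} {x} u → x < q → (x + u * q) / q ≡ u
digit-/ q {x} u x<q = trans (+-distrib-/-∣ʳ x (n∣m*n u)) (cong₂ _+_ (m<n⇒m/n≡0 x<q) (m*n/n≡m u q))

digit-< : ∀ {a b x u} → x < b → u < a → x + u * b < a * b
digit-< {a} {b} {x} {u} x<b u<a = <-≤-trans (+-monoˡ-< (u * b) x<b) (*-monoˡ-≤ b u<a)

-- The path system of quadratics

module Quadratics (h : ℕ) (pr : Prime (suc (h + h))) where

  q : ℕ
  q = suc (h + h)

  1≤h : 1 ≤ h
  1≤h = n≢0⇒n>0 λ { refl → ¬prime[1] pr }

  2<q : 2 < q
  2<q = s≤s (+-mono-≤ 1≤h 1≤h)

  #nodes : ℕ
  #nodes = (h + h) * q * q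

  -- The node v stands for the quadratic with coefficients X v, Y v and Z v ≠ 0.
  X Y Z : ℕ → ℕ
  X v = v % q
  Y v = v / q % q
  Z v = suc (v / q / q)

  -- The path i = c + t q consists of the quadratics P with P(t) = c whose
  -- derivative at t lies in the lower half {0, …, h} of the residues.
  Incident : ℕ → ℕ → Set
  Incident i v = i < q * q × v < #nodes ×
    value (i / q) (X v) (Y v) (Z v) % q ≡ i % q × slope (i / q) (Y v) (Z v) % q ≤ h

  incident? : ∀ i v → Dec (Incident i v)
  incident? i v = (i <? q * q) ×-dec (v <? #nodes) ×-dec
    (value (i / q) (X v) (Y v) (Z v) % q ≟ i % q) ×-dec (slope (i / q) (Y v) (Z v) % q ≤? h)

  Z< : ∀ {v} → v < #nodes → Z v < q
  Z< {v} v< = s≤s (m<n*o⇒m/o<n {v / q} {h + h} {q} (m<n*o⇒m/o<n {v} {(h + h) * q} {q} v<))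

  digits-injective : ∀ {v w} → v % q ≡ w % q → v / q ≡ w / q → v ≡ w
  digits-injective {v} {w} r≡ d≡ = trans (m≡m%n+[m/n]*n v q)
    (trans (cong₂ (λ a b → a + b * q) r≡ d≡) (sym (m≡m%n+[m/n]*n w q)))

  incident-reverses : ∀ {i j v w} → i ≢ j → v ≢ w → Incident i v → Incident i w → Incident j v → Incident j w →
    slope (i / q) (Y v) (Z v) % q ≤ slope (i / q) (Y w) (Z w) % q →
    slope (j / q) (Y v) (Z v) % q ≤ slope (j / q) (Y w) (Z w) % q → ⊥
  incident-reverses {i} {j} {v} {w} i≢j v≢w (i< , v< , iv , _) (_ , w< , iw , riw≤h) (j< , _ , jv , _) (_ , _ , jw , rjw≤h) ri rj =
    v≢w (same (slopes-opposite pr 2<q {x = X v} {y = Y v} {z = Z v} {x′ = X w} {y′ = Y w} {z′ = Z w} {t = i / q} {s = j / q}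
      (m%n<n v q) (m%n<n w q) (m%n<n (v / q) q) (m%n<n (w / q) q) (Z< v<) (Z< w<)
      (m<n*o⇒m/o<n {i} {q} {q} i<) (m<n*o⇒m/o<n {j} {q} {q} j<) t≢s (trans iv (sym iw)) (trans jv (sym jw)) ri rj
      -- Two residues from the lower half add up to at most 2h < q; this is what the restriction to
      -- half of the residues is for.
      (s≤s (+-mono-≤ riw≤h rjw≤h))))
    where
    same : X v ≡ X w × Y v ≡ Y w × Z v ≡ Z w → v ≡ w
    same (x≡ , y≡ , z≡) = digits-injective x≡ (digits-injective y≡ (suc-injective z≡))
    -- Paths with the same t and a common node have the same c, hence are equal.
    t≢s : i / q ≢ j / q
    t≢s t≡s = i≢j (digits-injective (trans (sym iv) (trans (cong (λ t → value t (X v) (Y v) (Z v) % q) t≡s) jv)) t≡s)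

  -- The numbers `n` and `p` are arbitrary: surplus nodes lie on no path and surplus paths are
  -- empty.
  module _ (n p : ℕ) where

    open SortedSystem {n} {p} (λ i v → incident? (toℕ i) (toℕ v)) (λ i v → slope (toℕ i / q) (Y (toℕ v)) (Z (toℕ v)) % q)
      public renaming (system to quadratics; size-system to size-quadratics)

    quadratics-reversing : Reversing (path quadratics)
    quadratics-reversing i j x y i≢j x≢y Pi Pj =
      let ix , iy , ri = Precedes⇒ i Pi
          jx , jy , rj = Precedes⇒ j Pj
      in incident-reverses (i≢j ∘ Fin.toℕ-injective) (x≢y ∘ Fin.toℕ-injective) ix iy jx jy ri rj

  q∤ : ∀ {a} → 1 ≤ a → a < q → ¬ (pos q ℤ.∣ pos a)
  q∤ 1≤a a<q d = >⇒∤ {{>-nonZero 1≤a}} a<q (ℤ.∣⇒∣ᵤ d)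

  -- An affine map with invertible leading coefficient permutes the residues.
  sum-affine : ∀ a b → ¬ (pos q ℤ.∣ pos a) → ∀ (g : ℕ → ℕ) →
    sum {q} (g ∘ toℕ) ≡ sum {q} (λ k → g ((b + a * toℕ k) % q))
  sum-affine a b q∤a g = trans (sum-injective φ φ-injective (g ∘ toℕ)) (sum-cong-≗ {q} λ k → cong g (toℕ-φ k))
    where
    φ : Fin q → Fin q
    φ k = fromℕ< (m%n<n (b + a * toℕ k) q)
    toℕ-φ : ∀ k → toℕ (φ k) ≡ (b + a * toℕ k) % q
    toℕ-φ k = Fin.toℕ-fromℕ< (m%n<n (b + a * toℕ k) q)
    φ-injective : Injective _≡_ _≡_ φ
    φ-injective {k} {l} eq = Fin.toℕ-injective (affine-injective pr 2<q a b q∤a (Fin.toℕ<n k) (Fin.toℕ<n l)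
      (trans (sym (toℕ-φ k)) (trans (cong toℕ eq) (toℕ-φ l))))

  half : suc h ≤ sum {q} (λ k → ⟦ toℕ k ≤? h ⟧)
  half = ≤-trans (≤-reflexive (sym (trans (cong (_* 1) (m≥n⇒m⊓n≡n (s≤s (m≤m+n h h)))) (*-identityʳ (suc h)))))
    (sum-prefix-≥ q (suc h) 1 (λ k → ⟦ k ≤? h ⟧) λ k k≤h → ⟦⟧-yes (k ≤? h) (s≤s⁻¹ k≤h))

  single : ∀ {c} → c < q → 1 ≤ sum {q} (λ k → ⟦ toℕ k ≟ c ⟧)
  single {c} c<q = ≤-trans (⟦⟧-yes (toℕ (fromℕ< c<q) ≟ c) (Fin.toℕ-fromℕ< c<q))
    (term≤sum {q} (λ k → ⟦ toℕ k ≟ c ⟧) (fromℕ< c<q))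

  -- For each of the 2h leading coefficients the slope runs through all residues with y, so h + 1
  -- values of y are admissible. For each of them some constant term gives the prescribed value.
  pathLength : ∀ i → i < q * q → (h + h) * suc h ≤ sum {#nodes} (λ v → ⟦ incident? i (toℕ v) ⟧)
  pathLength i i< = begin
    (h + h) * suc h
      ≤⟨ sum-≥ {h + h} _ (suc h) perZ ⟩
    sum {h + h} (λ z → sum {q} λ y → sum {q} λ x → F (toℕ x + (toℕ y + toℕ z * q) * q))
      ≡⟨ sum-digits (h + h) q (λ u → sum {q} λ x → F (toℕ x + u * q)) ⟨
    sum {(h + h) * q} (λ u → sum {q} λ x → F (toℕ x + toℕ u * q))
      ≡⟨ sum-digits ((h + h) * q) q F ⟨
    sum {#nodes} (F ∘ toℕ) ∎
    where
    open ≤-Reasoning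
    t = i / q
    F : ℕ → ℕ
    F v = ⟦ incident? i v ⟧
    -- Value and slope are written as affine functions with coefficient 1, to match `sum-affine`.
    -- The digit z stands for the leading coefficient z + 1.
    V : ℕ → ℕ → ℕ → ℕ
    V y z x = (t * y + t * t * suc z + 1 * x) % q
    R : ℕ → ℕ → ℕ
    R z y = (2 * t * suc z + 1 * y) % q
    rearrangeV : ∀ t x y z → t * y + t * t * z + 1 * x ≡ x + t * y + t * t * z
    rearrangeV = solve-∀
    rearrangeR : ∀ t y z → 2 * t * z + 1 * y ≡ y + 2 * t * z
    rearrangeR = solve-∀
    incident : ∀ {x y z} → x < q → y < q → z < h + h → V y z x ≡ i % q × R z y ≤ h → Incident i (x + (y + z * q) * q)
    incident {x} {y} {z} x< y< z< (v≡ , r≤) = i< , digit-< x< (digit-< y< z<) ,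
      trans (cong (_% q) (trans
        (cong₂ (λ a b → value t a (b % q) (suc (b / q))) (digit-% q (y + z * q) x<) (digit-/ q (y + z * q) x<))
        (trans (cong₂ (λ a b → value t x a (suc b)) (digit-% q z y<) (digit-/ q z y<)) (sym (rearrangeV t x y (suc z)))))) v≡ ,
      ≤-trans (≤-reflexive (cong (_% q) (trans
        (cong (λ b → slope t (b % q) (suc (b / q))) (digit-/ q (y + z * q) x<))
        (trans (cong₂ (λ a b → slope t a (suc b)) (digit-% q z y<) (digit-/ q z y<)) (sym (rearrangeR t y (suc z))))))) r≤
    perY : ∀ (z : Fin (h + h)) (y : Fin q) → ⟦ R (toℕ z) (toℕ y) ≤? h ⟧ ≤ sum {q} λ x → F (toℕ x + (toℕ y + toℕ z * q) * q)
    perY z y = begin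
      ⟦ R (toℕ z) (toℕ y) ≤? h ⟧
        ≡⟨ *-identityˡ ⟦ R (toℕ z) (toℕ y) ≤? h ⟧ ⟨
      1 * ⟦ R (toℕ z) (toℕ y) ≤? h ⟧
        ≤⟨ *-monoˡ-≤ ⟦ R (toℕ z) (toℕ y) ≤? h ⟧ (≤-trans (single (m%n<n i q))
             (≤-reflexive (sum-affine 1 (t * toℕ y + t * t * suc (toℕ z)) (q∤ ≤-refl (<-trans (n<1+n 1) 2<q)) (λ r → ⟦ r ≟ i % q ⟧)))) ⟩
      sum {q} (λ x → ⟦ V (toℕ y) (toℕ z) (toℕ x) ≟ i % q ⟧) * ⟦ R (toℕ z) (toℕ y) ≤? h ⟧
        ≡⟨ *-distribʳ-sum {q} ⟦ R (toℕ z) (toℕ y) ≤? h ⟧ (λ x → ⟦ V (toℕ y) (toℕ z) (toℕ x) ≟ i % q ⟧) ⟩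
      sum {q} (λ x → ⟦ V (toℕ y) (toℕ z) (toℕ x) ≟ i % q ⟧ * ⟦ R (toℕ z) (toℕ y) ≤? h ⟧)
        ≤⟨ sum-mono {q} (λ x → ≤-trans (≤-reflexive (sym (⟦⟧-× (V (toℕ y) (toℕ z) (toℕ x) ≟ i % q) (R (toℕ z) (toℕ y) ≤? h))))
             (⟦⟧-mono ((V (toℕ y) (toℕ z) (toℕ x) ≟ i % q) ×-dec (R (toℕ z) (toℕ y) ≤? h))
               (incident? i (toℕ x + (toℕ y + toℕ z * q) * q)) (incident (Fin.toℕ<n x) (Fin.toℕ<n y) (Fin.toℕ<n z)))) ⟩
      sum {q} (λ x → F (toℕ x + (toℕ y + toℕ z * q) * q)) ∎
    perZ : ∀ (z : Fin (h + h)) → suc h ≤ sum {q} λ y → sum {q} λ x → F (toℕ x + (toℕ y + toℕ z * q) * q)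
    perZ z = begin
      suc h                                       ≤⟨ half ⟩
      sum {q} (λ y → ⟦ toℕ y ≤? h ⟧)              ≡⟨ sum-affine 1 (2 * t * suc (toℕ z)) (q∤ ≤-refl (<-trans (n<1+n 1) 2<q)) (λ r → ⟦ r ≤? h ⟧) ⟩
      sum {q} (λ y → ⟦ R (toℕ z) (toℕ y) ≤? h ⟧)  ≤⟨ sum-mono {q} (perY z) ⟩
      sum {q} (λ y → sum {q} λ x → F (toℕ x + (toℕ y + toℕ z * q) * q)) ∎

  -- The derivative of a fixed quadratic is affine in t with coefficient 2Z, nonzero modulo `q`
  -- because Z is. So h + 1 values of t are admissible, and each determines c.
  nodeDegree : ∀ v → v < #nodes → suc h ≤ sum {q * q} (λ i → ⟦ incident? (toℕ i) v ⟧)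
  nodeDegree v v< = begin
    suc h
      ≤⟨ half ⟩
    sum {q} (λ t → ⟦ toℕ t ≤? h ⟧)
      ≡⟨ sum-affine (2 * Z v) (Y v) q∤2Z (λ r → ⟦ r ≤? h ⟧) ⟩
    sum {q} (λ t → ⟦ R (toℕ t) ≤? h ⟧)
      ≤⟨ sum-mono {q} perT ⟩
    sum {q} (λ t → sum {q} λ c → F (toℕ c + toℕ t * q))
      ≡⟨ sum-digits q q F ⟨
    sum {q * q} (F ∘ toℕ) ∎
    where
    open ≤-Reasoning
    F : ℕ → ℕ
    F i = ⟦ incident? i v ⟧
    R : ℕ → ℕ
    R t = (Y v + 2 * Z v * t) % q
    V : ℕ → ℕ
    V t = value t (X v) (Y v) (Z v) % q
    q∤2Z : ¬ (pos q ℤ.∣ pos (2 * Z v))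
    q∤2Z d = q∤product (euclidsLemma 2 (Z v) pr (ℤ.∣⇒∣ᵤ d))
      where
      q∤product : ¬ (q ∣ 2 ⊎ q ∣ Z v)
      q∤product (inj₁ q∣2) = >⇒∤ 2<q q∣2
      q∤product (inj₂ q∣Z) = >⇒∤ (Z< v<) q∣Z
    rearrangeR : ∀ t y z → y + 2 * z * t ≡ y + 2 * t * z
    rearrangeR = solve-∀
    incident : ∀ {t c} → t < q → c < q → c ≡ V t × R t ≤ h → Incident (c + t * q) v
    incident {t} {c} t< c< (c≡ , r≤) = digit-< c< t< , v< ,
      trans (cong (λ s → value s (X v) (Y v) (Z v) % q) (digit-/ q t c<)) (trans (sym c≡) (sym (digit-% q t c<))) ,
      ≤-trans (≤-reflexive (cong (_% q) (trans (cong (λ s → slope s (Y v) (Z v)) (digit-/ q t c<)) (sym (rearrangeR t (Y v) (Z v)))))) r≤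
    perT : ∀ (t : Fin q) → ⟦ R (toℕ t) ≤? h ⟧ ≤ sum {q} λ c → F (toℕ c + toℕ t * q)
    perT t = begin
      ⟦ R (toℕ t) ≤? h ⟧
        ≡⟨ *-identityˡ ⟦ R (toℕ t) ≤? h ⟧ ⟨
      1 * ⟦ R (toℕ t) ≤? h ⟧
        ≤⟨ *-monoˡ-≤ ⟦ R (toℕ t) ≤? h ⟧ (single (m%n<n (value (toℕ t) (X v) (Y v) (Z v)) q)) ⟩
      sum {q} (λ c → ⟦ toℕ c ≟ V (toℕ t) ⟧) * ⟦ R (toℕ t) ≤? h ⟧
        ≡⟨ *-distribʳ-sum {q} ⟦ R (toℕ t) ≤? h ⟧ (λ c → ⟦ toℕ c ≟ V (toℕ t) ⟧) ⟩
      sum {q} (λ c → ⟦ toℕ c ≟ V (toℕ t) ⟧ * ⟦ R (toℕ t) ≤? h ⟧)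
        ≤⟨ sum-mono {q} (λ c → ≤-trans (≤-reflexive (sym (⟦⟧-× (toℕ c ≟ V (toℕ t)) (R (toℕ t) ≤? h))))
             (⟦⟧-mono ((toℕ c ≟ V (toℕ t)) ×-dec (R (toℕ t) ≤? h)) (incident? (toℕ c + toℕ t * q) v)
               (incident (Fin.toℕ<n t) (Fin.toℕ<n c)))) ⟩
      sum {q} (λ c → F (toℕ c + toℕ t * q)) ∎

  size-quadratics-paths : ∀ n p → #nodes ≤ n → (p ⊓ (q * q)) * ((h + h) * suc h) ≤ size (quadratics n p)
  size-quadratics-paths n p N≤n = ≤-trans
    (sum-prefix-≥ p (q * q) _ (λ i → sum {n} λ v → ⟦ incident? i (toℕ v) ⟧)
      λ i i< → ≤-trans (pathLength i i<) (sum-prefix (λ v → ⟦ incident? i v ⟧) N≤n))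
    (≤-reflexive (sym (size-quadratics n p)))

  size-quadratics-nodes : ∀ n p → q * q ≤ p → (n ⊓ #nodes) * suc h ≤ size (quadratics n p)
  size-quadratics-nodes n p Q≤p = ≤-trans
    (sum-prefix-≥ n #nodes _ (λ v → sum {p} λ i → ⟦ incident? (toℕ i) v ⟧)
      λ v v< → ≤-trans (nodeDegree v v<) (sum-prefix (λ i → ⟦ incident? i v ⟧) Q≤p))
    (≤-reflexive (trans (∑-comm {n} {p} λ v i → ⟦ incident? (toℕ i) (toℕ v) ⟧) (sym (size-quadratics n p))))

-- The lower bound

square-cancel-≤ : ∀ {a b} → a * a ≤ b * b → a ≤ b
square-cancel-≤ a²≤b² = ≮⇒≥ λ b<a → <⇒≱ (*-mono-< b<a b<a) a²≤b²

cube-cancel-≤ : ∀ {a b} → a * (a * a) ≤ b * (b * b) → a ≤ b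
cube-cancel-≤ a³≤b³ = ≮⇒≥ λ b<a → <⇒≱ (*-mono-< b<a (*-mono-< b<a b<a)) a³≤b³

cube-mono-≤ : ∀ {a b} → a ≤ b → a * (a * a) ≤ b * (b * b)
cube-mono-≤ a≤b = *-mono-≤ a≤b (*-mono-≤ a≤b a≤b)

≤-scale-⊓ : ∀ {a b} c → 1 ≤ c → a ≤ c * b → a ≤ c * (a ⊓ b)
≤-scale-⊓ {a} {b} c 1≤c a≤cb with ⊓-sel a b
... | inj₁ eq = ≤-trans (m≤n*m a c {{>-nonZero 1≤c}}) (≤-reflexive (cong (c *_) (sym eq)))
... | inj₂ eq = ≤-trans a≤cb (≤-reflexive (cong (c *_) (sym eq)))

module LowerBound (K : ℕ)
  (oddPrimeNear : ∀ x → 3 ≤ x → ∃ λ h → Prime (suc (h + h)) × suc (h + h) ≤ x × x ≤ K * suc (h + h))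
  (n p : ℕ) (1≤n : 1 ≤ n) (1≤p : 1 ≤ p)
  (m : ℕ) (largest : ∀ (T : PathSystem n p) → Reversing (path T) → size T ≤ m) where

  open ≤-Reasoning

  private
    K⁴ = K * K * (K * K)
    s = root 2 p
    t = root 3 (n ^ 2)

    t³≤n² : t * (t * t) ≤ n * n
    t³≤n² = ≤-trans (root₃ (n ^ 2)) (≤-reflexive (^2≡ n))

    1≤K : ∀ {x q} → 3 ≤ x → x ≤ K * q → 1 ≤ K
    1≤K 3≤x x≤Kq = n≢0⇒n>0 λ { refl → contradiction (≤-trans 3≤x x≤Kq) λ () }

  -- The spanning system has size n + p - 1, which is at least half of n + p.
  n+p≤2m : n + p ≤ 2 * m
  n+p≤2m = spanning n p 1≤n 1≤p largest
    where
    spanning : ∀ n p → 1 ≤ n → 1 ≤ p → (∀ (T : PathSystem n p) → Reversing (path T) → size T ≤ m) → n + p ≤ 2 * m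
    spanning (suc n) (suc p) _ _ largest = begin
      suc n + suc p                     ≤⟨ m≤m+n _ (n + p) ⟩
      suc n + suc p + (n + p)           ≡⟨ double n p ⟩
      2 * (suc n + p)                   ≡⟨ cong (2 *_) (size-spanningSystem n p) ⟨
      2 * size (spanningSystem n p)     ≤⟨ *-monoʳ-≤ 2 (largest (spanningSystem n p) (spanningSystem-reversing n p)) ⟩
      2 * m                             ∎
      where
      double : ∀ n p → suc n + suc p + (n + p) ≡ 2 * (suc n + p)
      double = solve-∀

  n≤2m : n ≤ 2 * m
  n≤2m = ≤-trans (m≤m+n n p) n+p≤2m

  p≤2m : p ≤ 2 * m
  p≤2m = ≤-trans (m≤n+m p n) n+p≤2m

  -- With q near n^(1/3) all quadratics fit into the `n` nodes. As p ≤ n^(2/3) is of order at most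
  -- q², a constant fraction of the paths carries nodes, each of them about q²/2.
  fewPaths-prime : p * (p * p) ≤ n * n → ∀ h → Prime (suc (h + h)) →
    let q = suc (h + h) in q ≤ root 3 n → root 3 n ≤ K * q → 1 ≤ K → t * p ≤ 80 * K⁴ * m
  fewPaths-prime p³≤n² h pr q≤u u≤Kq 1≤K = begin
    t * p
      ≤⟨ *-mono-≤ (≤-trans t≤W (*-monoʳ-≤ (4 * (K * K)) q²≤5L)) (≤-scale-⊓ (4 * (K * K)) (*-mono-≤ (s≤s (z≤n {3})) (*-mono-≤ 1≤K 1≤K)) p≤W) ⟩
    4 * (K * K) * (5 * L) * (4 * (K * K) * (p ⊓ (q * q)))
      ≡⟨ collect (K * K) L (p ⊓ (q * q)) ⟩
    80 * K⁴ * ((p ⊓ (q * q)) * L)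
      ≤⟨ *-monoʳ-≤ (80 * K⁴) (≤-trans (size-quadratics-paths n p N≤n) (largest (quadratics n p) (quadratics-reversing n p))) ⟩
    80 * K⁴ * m ∎
    where
    open Quadratics h pr
    u = root 3 n
    w = K * q
    L = (h + h) * suc h
    -- Chosen so that n ≤ 8 (K q)³ becomes n² ≤ W³; both `t` and `p` are then at most `W`.
    W = 4 * (K * K) * (q * q)
    collect : ∀ k l b → 4 * k * (5 * l) * (4 * k * b) ≡ 80 * (k * k) * (b * l)
    collect = solve-∀
    N≤n : #nodes ≤ n
    N≤n = begin
      (h + h) * q * q     ≤⟨ *-monoˡ-≤ q (*-monoˡ-≤ q (n≤1+n (h + h))) ⟩
      q * q * q           ≡⟨ *-assoc q q q ⟩
      q * (q * q)         ≤⟨ cube-mono-≤ q≤u ⟩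
      u * (u * u)         ≤⟨ root₃ n ⟩
      n                   ∎
    n²≤W³ : n * n ≤ W * (W * W)
    n²≤W³ = begin
      n * n                                          ≤⟨ *-mono-≤ n≤8w³ n≤8w³ ⟩
      8 * (w * (w * w)) * (8 * (w * (w * w)))        ≡⟨ regroup K q ⟩
      W * (W * W)                                    ∎
      where
      n≤8w³ : n ≤ 8 * (w * (w * w))
      n≤8w³ = ≤-trans (≤8root₃ n 1≤n) (*-monoʳ-≤ 8 (cube-mono-≤ u≤Kq))
      regroup : ∀ k q → 8 * (k * q * (k * q * (k * q))) * (8 * (k * q * (k * q * (k * q))))
        ≡ 4 * (k * k) * (q * q) * (4 * (k * k) * (q * q) * (4 * (k * k) * (q * q)))
      regroup = solve-∀
    p≤W : p ≤ W
    p≤W = cube-cancel-≤ (≤-trans p³≤n² n²≤W³)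
    t≤W : t ≤ W
    t≤W = cube-cancel-≤ (≤-trans t³≤n² n²≤W³)
    q²≤5L : q * q ≤ 5 * L
    q²≤5L = begin
      q * q                                       ≤⟨ m≤m+n _ (6 * (h * h) + 5 * h) ⟩
      q * q + (6 * (h * h) + 5 * h)               ≡⟨ expand h ⟩
      10 * (h * h) + 9 * h + 1                    ≤⟨ +-monoʳ-≤ (10 * (h * h) + 9 * h) 1≤h ⟩
      10 * (h * h) + 9 * h + h                    ≡⟨ expand′ h ⟩
      5 * L                                       ∎
      where
      expand : ∀ h → suc (h + h) * suc (h + h) + (6 * (h * h) + 5 * h) ≡ 10 * (h * h) + 9 * h + 1
      expand = solve-∀
      expand′ : ∀ h → 10 * (h * h) + 9 * h + h ≡ 5 * ((h + h) * suc h)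
      expand′ = solve-∀

  fewPaths : p * (p * p) ≤ n * n → t * p ≤ (80 * K⁴ + 18) * m
  fewPaths p³≤n² with 3 ≤? root 3 n
  ... | yes 3≤u = let h , pr , q≤u , u≤Kq = oddPrimeNear (root 3 n) 3≤u in
    ≤-trans (fewPaths-prime p³≤n² h pr q≤u u≤Kq (1≤K 3≤u u≤Kq)) (*-monoˡ-≤ m (m≤m+n (80 * K⁴) 18))
  -- No odd prime is small enough here, but n ≤ 27 and t ≤ 9, so the linear term suffices.
  ... | no 3≰u = begin
    t * p                  ≤⟨ *-mono-≤ t≤9 p≤2m ⟩
    9 * (2 * m)            ≡⟨ *-assoc 9 2 m ⟨
    18 * m                 ≤⟨ *-monoˡ-≤ m (m≤n+m 18 (80 * K⁴)) ⟩
    (80 * K⁴ + 18) * m     ∎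
    where
    n≤27 : n ≤ 27
    n≤27 = ≤-trans (<⇒≤ (<root^ 3 n (s≤s z≤n))) (^-monoˡ-≤ 3 (≰⇒> 3≰u))
    t≤9 : t ≤ 9
    t≤9 = cube-cancel-≤ {t} {9} (≤-trans t³≤n² (*-mono-≤ n≤27 n≤27))

  -- With q near √p all q² paths fit. As n ≤ p^(3/2) is of order at most q³, a constant fraction of
  -- the nodes stands for quadratics, and each of these lies on more than q/2 paths.
  manyPaths-prime : n * n ≤ p * (p * p) → ∀ h → Prime (suc (h + h)) →
    let q = suc (h + h) in q ≤ s → s ≤ K * q → 1 ≤ K → n * s ≤ 80 * K⁴ * m
  manyPaths-prime n²≤p³ h pr q≤s s≤Kq 1≤K = begin
    n * s
      ≤⟨ *-mono-≤ (≤-scale-⊓ (16 * (K * K * K)) (*-mono-≤ (s≤s (z≤n {15})) (*-mono-≤ (*-mono-≤ 1≤K 1≤K) 1≤K)) n≤16K³N) (≤-trans s≤Kq (*-monoʳ-≤ K q≤2[1+h])) ⟩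
    16 * (K * K * K) * (n ⊓ #nodes) * (K * (2 * suc h))
      ≡⟨ collect K (n ⊓ #nodes) (suc h) ⟩
    32 * K⁴ * ((n ⊓ #nodes) * suc h)
      ≤⟨ *-mono-≤ (*-monoˡ-≤ K⁴ (m≤m+n 32 48)) (≤-trans (size-quadratics-nodes n p q²≤p) (largest (quadratics n p) (quadratics-reversing n p))) ⟩
    80 * K⁴ * m ∎
    where
    open Quadratics h pr
    w = K * q
    collect : ∀ k b c → 16 * (k * k * k) * b * (k * (2 * c)) ≡ 32 * (k * k * (k * k)) * (b * c)
    collect = solve-∀
    q²≤p : q * q ≤ p
    q²≤p = ≤-trans (*-mono-≤ q≤s q≤s) (root₂ p)
    q≤2[1+h] : q ≤ 2 * suc h
    q≤2[1+h] = ≤-trans (n≤1+n q) (≤-reflexive (double h))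
      where
      double : ∀ h → suc (suc (h + h)) ≡ 2 * suc h
      double = solve-∀
    q≤2[2h] : q ≤ 2 * (h + h)
    q≤2[2h] = begin
      1 + (h + h)              ≤⟨ +-monoˡ-≤ (h + h) (≤-trans 1≤h (m≤m+n h (h + 0))) ⟩
      h + (h + 0) + (h + h)    ≡⟨ double h ⟩
      2 * (h + h)              ∎
      where
      double : ∀ h → h + (h + 0) + (h + h) ≡ 2 * (h + h)
      double = solve-∀
    n≤8w³ : n ≤ 8 * (w * (w * w))
    n≤8w³ = square-cancel-≤ (begin
      n * n                                        ≤⟨ n²≤p³ ⟩
      p * (p * p)                                  ≤⟨ cube-mono-≤ (≤-trans (≤4root₂ p 1≤p) (*-monoʳ-≤ 4 (*-mono-≤ s≤Kq s≤Kq))) ⟩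
      4 * (w * w) * (4 * (w * w) * (4 * (w * w)))  ≡⟨ regroup w ⟩
      8 * (w * (w * w)) * (8 * (w * (w * w)))      ∎)
      where
      regroup : ∀ w → 4 * (w * w) * (4 * (w * w) * (4 * (w * w))) ≡ 8 * (w * (w * w)) * (8 * (w * (w * w)))
      regroup = solve-∀
    n≤16K³N : n ≤ 16 * (K * K * K) * #nodes
    n≤16K³N = begin
      n                                        ≤⟨ n≤8w³ ⟩
      8 * (w * (w * w))                        ≡⟨ regroup K q ⟩
      8 * (K * K * K) * (q * q * q)            ≤⟨ *-monoʳ-≤ (8 * (K * K * K)) (*-monoˡ-≤ q (*-monoˡ-≤ q q≤2[2h])) ⟩
      8 * (K * K * K) * (2 * (h + h) * q * q)  ≡⟨ regroup′ (K * K * K) (h + h) q ⟩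
      16 * (K * K * K) * ((h + h) * q * q)     ∎
      where
      regroup : ∀ k q → 8 * (k * q * (k * q * (k * q))) ≡ 8 * (k * k * k) * (q * q * q)
      regroup = solve-∀
      regroup′ : ∀ k a q → 8 * k * (2 * a * q * q) ≡ 16 * k * (a * q * q)
      regroup′ = solve-∀

  manyPaths : n * n ≤ p * (p * p) → n * s ≤ (80 * K⁴ + 18) * m
  manyPaths n²≤p³ with 3 ≤? s
  ... | yes 3≤s = let h , pr , q≤s , s≤Kq = oddPrimeNear s 3≤s in
    ≤-trans (manyPaths-prime n²≤p³ h pr q≤s s≤Kq (1≤K 3≤s s≤Kq)) (*-monoˡ-≤ m (m≤m+n (80 * K⁴) 18))
  -- Now s ≤ 2, and again the linear term suffices.
  ... | no 3≰s = begin
    n * s                  ≤⟨ *-mono-≤ n≤2m (s≤s⁻¹ (≰⇒> 3≰s)) ⟩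
    2 * m * 2              ≡⟨ four m ⟩
    4 * m                  ≤⟨ *-monoˡ-≤ m (≤-trans (m≤m+n 4 14) (m≤n+m 18 (80 * K⁴))) ⟩
    (80 * K⁴ + 18) * m     ∎
    where
    four : ∀ m → 2 * m * 2 ≡ 4 * m
    four = solve-∀

  bound≤ : bound n p ≤ (80 * K⁴ + 20) * m
  bound≤ = begin
    (n * s) ⊓ (t * p) + n + p          ≡⟨ +-assoc ((n * s) ⊓ (t * p)) n p ⟩
    (n * s) ⊓ (t * p) + (n + p)        ≤⟨ +-mono-≤ minimum n+p≤2m ⟩
    (80 * K⁴ + 18) * m + 2 * m         ≡⟨ collect K⁴ m ⟩
    (80 * K⁴ + 20) * m                 ∎
    where
    collect : ∀ k m → (80 * k + 18) * m + 2 * m ≡ (80 * k + 20) * m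
    collect = solve-∀
    minimum : (n * s) ⊓ (t * p) ≤ (80 * K⁴ + 18) * m
    -- The two arguments of the minimum balance at p³ = n²; on either side the construction reaches
    -- one of them up to a constant.
    minimum with ≤-total (p * (p * p)) (n * n)
    ... | inj₁ p³≤n² = ≤-trans (m⊓n≤n (n * s) (t * p)) (fewPaths p³≤n²)
    ... | inj₂ n²≤p³ = ≤-trans (m⊓n≤m (n * s) (t * p)) (manyPaths n²≤p³)

mainTheorem1 : Σ ℕ λ c → Σ ℕ λ C → ∀ (n p : ℕ) → 1 ≤ n → 1 ≤ p →
    Σ ℕ λ m → IsBeta n p 2 m × IsBetaStar n p 2 m × (bound n p ≤ c * m) × (m ≤ C * bound n p)
mainTheorem1 = 80 * (K * K * (K * K)) + 20 , 9 , λ n p 1≤n 1≤p →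
  -- One system attains both maxima: it has girth greater than 2, and every competitor, ordered or
  -- not, is reversing.
  let S , rev , largest = largestReversing n p
      gt = reversing⇒girth S rev
      reversing = orderedGirth⇒reversing
  in size S
   , ((S , gt , refl) , λ T gtT → largest T (reversing T (girth⇒orderedGirth T gtT)))
   , ((S , girth⇒orderedGirth S gt , refl) , λ T gtT → largest T (reversing T gtT))
   , LowerBound.bound≤ K (proj₂ oddPrimesDense) n p 1≤n 1≤p (size S) largest
   , size≤bound S rev 1≤n 1≤p
  where K = proj₁ oddPrimesDense
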